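{- For every fixed positive integer $\ell$ we have $\mathrm{ind}(k,\ell) \le \frac{3}{4} + o_k(1)$, that is, for every $\varepsilon > 0$ there exists $k_0 = k_0(\ell,\varepsilon)$ such that $\mathrm{ind}(k,\ell) \le \frac34 + \varepsilon$ for all integers $k \ge k_0$. Moreover, for $\ell = 1$ we have $\mathrm{ind}(k,1) \le \frac{1}{2} + o_k(1)$, that is, for every $\varepsilon > 0$ there exists $k_0 = k_0(\varepsilon)$ such that $\mathrm{ind}(k,1) \le \frac12 + \varepsilon$ for all integers $k \ge k_0$.
   Context: All graphs are finite and simple. For a positive integer $k$ and a graph $G$ with at least $k$ vertices, let $A = A_{G,k}$ be chosen uniformly at random from all $k$-element subsets of $V(G)$, and let $X_{G,k} = e(G[A])$ be the number of edges of $G$ with both endpoints in $A$. For integers $n \ge k$ and $0 \le \ell \le \binom{k}{2}$ let $I(n,k,\ell) = \max\{\mathbb{P}(X_{G,k} = \ell) : G \text{ is a graph on } n \text{ vertices}\}$. For fixed $k,\ell$ the sequence $I(n,k,\ell)$ is non-increasing in $n$, and the edge-inducibility is defined by $\mathrm{ind}(k,\ell) := \lim_{n\to\infty} I(n,k,\ell)$. -}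

module Defs where

open import Algebra.Properties.Group using ()
open import Algebra.Properties.Semiring.Sum using ()
open import Data.Bool.Base using (Bool; true; false; _∧_; if_then_else_)
open import Data.Fin.Base using (Fin; zero; suc; toℕ)
open import Data.Fin.Subset using (Subset; inside; outside; ∣_∣)
open import Data.Integer.Base as ℤ using (+_; +[1+_]; -[1+_])
import Data.Integer.Properties as ℤₚ
open import Data.List.Base
  using (List; []; _∷_; _++_; map; filter; length; cartesianProductWith)
open import Data.List.Extrema using ()
open import Data.List.Membership.Propositional using (_∈_)
open import Data.List.Membership.Propositional.Properties
  using (∈-cartesianProductWith⁺; ∈-++⁺ˡ; ∈-++⁺ʳ; ∈-map⁺; ∈-map⁻)
import Data.List.Properties as Listₚ
import Data.List.Relation.Unary.All as All
open import Data.List.Relation.Unary.Any using (here)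
open import Data.List.Relation.Binary.Permutation.Propositional using (_↭_; prep; swap)
import Data.List.Relation.Binary.Permutation.Propositional as Perm
open import Data.Nat.Base as ℕ
  using (ℕ; zero; suc; NonZero; _+_; _*_; _^_; _!; _≤_; _<_; z≤n; s≤s; _<ᵇ_; _≡ᵇ_)
open import Data.Nat.Coprimality using (Coprime)
import Data.Nat.Properties as ℕₚ
open import Data.Nat.Solver using (module +-*-Solver)
open import Data.Product.Base using (∃-syntax; _×_; _,_)
open import Data.Rational.Base as ℚ using (ℚ; mkℚ; 0ℚ; _/_)
import Data.Rational.Properties as ℚₚ
import Data.Rational.Unnormalised.Base as ℚᵘ
import Data.Rational.Unnormalised.Properties as ℚᵘₚ
open import Data.Sum.Base using (_⊎_; inj₁; inj₂)
open import Data.Vec.Base as Vec using (Vec; []; _∷_; lookup; tabulate)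
import Data.Vec.Properties as Vecₚ
open import Function.Base using (_∘_; id)
open import Level using (0ℓ)
open import Relation.Binary.Bundles using (DecTotalOrder)
open import Relation.Binary.PropositionalEquality
open import Relation.Nullary using (does)
open import Relation.Unary using (Pred; Decidable)

open Algebra.Properties.Semiring.Sum ℕₚ.+-*-semiring using (sum; sum-syntax; sum-cong-≗)
open Algebra.Properties.Group ℚₚ.+-0-group using (//-rightDividesʳ; ⁻¹-anti-homo-//)
open +-*-Solver using (solve; con; _:+_; _:*_; _:=_)
open Data.List.Extrema (DecTotalOrder.totalOrder ℚₚ.≤-decTotalOrder) using (max; argmax-sel; xs≤max)

record Graph (n : ℕ) : Set where
  field
    adj        : Fin n → Fin n → Bool
    adj-sym    : ∀ i j → adj i j ≡ adj j i
    adj-irrefl : ∀ i → adj i i ≡ false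

open Graph public

𝟙 : Bool → ℕ
𝟙 b = if b then 1 else 0

-- Requiring i < j makes each edge count once.
edgesIn : ∀ {n} → (Fin n → Fin n → Bool) → Subset n → ℕ
edgesIn {n} E A =
  ∑[ i < n ] ∑[ j < n ] 𝟙 ((toℕ i <ᵇ toℕ j) ∧ lookup A i ∧ lookup A j ∧ E i j)

e : ∀ {n} → Graph n → Subset n → ℕ
e G = edgesIn (adj G)

subsets : ∀ n → List (Subset n)
subsets zero    = [] ∷ []
subsets (suc n) = map (outside ∷_) (subsets n) ++ map (inside ∷_) (subsets n)

kSubsets : ∀ n → ℕ → List (Subset n)
kSubsets n k = filter (λ A → ∣ A ∣ ℕₚ.≟ k) (subsets n)

-- A sum over the k-subsets of Fin n is rewritten as a sum over the length-k
-- sublists of a list (subΣ), on which the inductions below run.  This serves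
-- only to show that there are k-subsets and that n ↦ I(n,k,ℓ) converges.
lsum : ∀ {X : Set} → (X → ℕ) → List X → ℕ
lsum f []       = 0
lsum f (x ∷ xs) = f x + lsum f xs

subΣ : ∀ {X : Set} → List X → ℕ → (List X → ℕ) → ℕ
subΣ []       zero    g = g []
subΣ []       (suc k) g = 0
subΣ (x ∷ xs) zero    g = subΣ xs zero g
subΣ (x ∷ xs) (suc k) g = subΣ xs (suc k) g + subΣ xs k (g ∘ (x ∷_))

lsum-++ : ∀ {X : Set} (f : X → ℕ) xs ys → lsum f (xs ++ ys) ≡ lsum f xs + lsum f ys
lsum-++ f []       ys = refl
lsum-++ f (x ∷ xs) ys =
  trans (cong (_+_ (f x)) (lsum-++ f xs ys)) (sym (ℕₚ.+-assoc (f x) _ _))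

lsum-map : ∀ {X Y : Set} (f : Y → ℕ) (h : X → Y) xs → lsum f (map h xs) ≡ lsum (f ∘ h) xs
lsum-map f h []       = refl
lsum-map f h (x ∷ xs) = cong (_+_ (f (h x))) (lsum-map f h xs)

lsum-0 : ∀ {X : Set} (xs : List X) → lsum (λ _ → 0) xs ≡ 0
lsum-0 []       = refl
lsum-0 (x ∷ xs) = lsum-0 xs

lsum-cong : ∀ {X : Set} {f g : X → ℕ} → (∀ x → f x ≡ g x) → ∀ xs → lsum f xs ≡ lsum g xs
lsum-cong f≗g []       = refl
lsum-cong f≗g (x ∷ xs) = cong₂ _+_ (f≗g x) (lsum-cong f≗g xs)

lsum-mono : ∀ {X : Set} {f g : X → ℕ} → (∀ x → f x ≤ g x) → ∀ xs → lsum f xs ≤ lsum g xs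
lsum-mono f≤g []       = z≤n
lsum-mono f≤g (x ∷ xs) = ℕₚ.+-mono-≤ (f≤g x) (lsum-mono f≤g xs)

lsum-+ : ∀ {X : Set} (f g : X → ℕ) xs → lsum (λ x → f x + g x) xs ≡ lsum f xs + lsum g xs
lsum-+ f g []       = refl
lsum-+ f g (x ∷ xs) = trans (cong (_+_ (f x + g x)) (lsum-+ f g xs))
                            (shuffle (f x) (g x) (lsum f xs) (lsum g xs))
  where
  shuffle : ∀ a b c d → (a + b) + (c + d) ≡ (a + c) + (b + d)
  shuffle = solve 4 (λ a b c d →
    (a :+ b) :+ (c :+ d) := (a :+ c) :+ (b :+ d)) refl

lsum-* : ∀ {X : Set} c (f : X → ℕ) xs → lsum (λ x → c * f x) xs ≡ c * lsum f xs
lsum-* c f []       = sym (ℕₚ.*-zeroʳ c)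
lsum-* c f (x ∷ xs) = trans (cong (_+_ (c * f x)) (lsum-* c f xs))
                            (sym (ℕₚ.*-distribˡ-+ c (f x) _))

lsum-const : ∀ {X : Set} c (xs : List X) → lsum (λ _ → c) xs ≡ length xs * c
lsum-const c []       = refl
lsum-const c (x ∷ xs) = cong (_+_ c) (lsum-const c xs)

length-filter : ∀ {X : Set} {P : Pred X 0ℓ} (P? : Decidable P) xs →
                length (filter P? xs) ≡ lsum (𝟙 ∘ does ∘ P?) xs
length-filter P? []       = refl
length-filter P? (x ∷ xs) with does (P? x)
... | true  = cong suc (length-filter P? xs)
... | false = length-filter P? xs

lsum-filter : ∀ {X : Set} {P : Pred X 0ℓ} (P? : Decidable P) (f : X → ℕ) xs →
              lsum f (filter P? xs) ≡ lsum (λ x → 𝟙 (does (P? x)) * f x) xs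
lsum-filter P? f []       = refl
lsum-filter P? f (x ∷ xs) with does (P? x)
... | true  = cong₂ _+_ (sym (ℕₚ.+-identityʳ (f x))) (lsum-filter P? f xs)
... | false = lsum-filter P? f xs

elems : ∀ {X : Set} {n} → Subset n → Vec X n → List X
elems []          []       = []
elems (true  ∷ A) (x ∷ xs) = x ∷ elems A xs
elems (false ∷ A) (x ∷ xs) = elems A xs

lsum-weighted : ∀ {X : Set} {n} (xs : Vec X n) k (g : List X → ℕ) →
  lsum (λ A → 𝟙 (does (∣ A ∣ ℕₚ.≟ k)) * g (elems A xs)) (subsets n)
    ≡ subΣ (Vec.toList xs) k g
lsum-weighted [] zero    g = trans (ℕₚ.+-identityʳ _) (ℕₚ.+-identityʳ _)
lsum-weighted [] (suc k) g = refl
lsum-weighted {n = suc n} (x ∷ xs) zero g = begin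
  lsum w (map (outside ∷_) (subsets n) ++ map (inside ∷_) (subsets n))
    ≡⟨ lsum-++ w (map (outside ∷_) (subsets n)) _ ⟩
  lsum w (map (outside ∷_) (subsets n)) + lsum w (map (inside ∷_) (subsets n))
    ≡⟨ cong₂ _+_ (lsum-map w (outside ∷_) (subsets n)) (lsum-map w (inside ∷_) (subsets n)) ⟩
  lsum (w ∘ (outside ∷_)) (subsets n) + lsum (λ _ → 0) (subsets n)
    ≡⟨ cong₂ _+_ (lsum-weighted xs zero g) (lsum-0 (subsets n)) ⟩
  subΣ (Vec.toList xs) zero g + 0
    ≡⟨ ℕₚ.+-identityʳ _ ⟩
  subΣ (Vec.toList xs) zero g ∎
  where
  open ≡-Reasoning
  w = λ A → 𝟙 (does (∣ A ∣ ℕₚ.≟ zero)) * g (elems A (x ∷ xs))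
lsum-weighted {n = suc n} (x ∷ xs) (suc k) g = begin
  lsum w (map (outside ∷_) (subsets n) ++ map (inside ∷_) (subsets n))
    ≡⟨ lsum-++ w (map (outside ∷_) (subsets n)) _ ⟩
  lsum w (map (outside ∷_) (subsets n)) + lsum w (map (inside ∷_) (subsets n))
    ≡⟨ cong₂ _+_ (lsum-map w (outside ∷_) (subsets n)) (lsum-map w (inside ∷_) (subsets n)) ⟩
  lsum (w ∘ (outside ∷_)) (subsets n) + lsum (w ∘ (inside ∷_)) (subsets n)
    ≡⟨ cong₂ _+_ (lsum-weighted xs (suc k) g) (lsum-weighted xs k (g ∘ (x ∷_))) ⟩
  subΣ (Vec.toList xs) (suc k) g + subΣ (Vec.toList xs) k (g ∘ (x ∷_)) ∎
  where
  open ≡-Reasoning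
  w = λ A → 𝟙 (does (∣ A ∣ ℕₚ.≟ suc k)) * g (elems A (x ∷ xs))

lsum-kSubsets : ∀ {X : Set} {n} (xs : Vec X n) k (g : List X → ℕ) →
  lsum (λ A → g (elems A xs)) (kSubsets n k) ≡ subΣ (Vec.toList xs) k g
lsum-kSubsets {n = n} xs k g =
  trans (lsum-filter (λ A → ∣ A ∣ ℕₚ.≟ k) _ (subsets n)) (lsum-weighted xs k g)

binom : ℕ → ℕ → ℕ
binom zero    zero    = 1
binom zero    (suc k) = 0
binom (suc n) zero    = binom n zero
binom (suc n) (suc k) = binom n (suc k) + binom n k

subΣ-1 : ∀ {X : Set} (xs : List X) k → subΣ xs k (λ _ → 1) ≡ binom (length xs) k
subΣ-1 []       zero    = refl
subΣ-1 []       (suc k) = refl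
subΣ-1 (x ∷ xs) zero    = subΣ-1 xs zero
subΣ-1 (x ∷ xs) (suc k) = cong₂ _+_ (subΣ-1 xs (suc k)) (subΣ-1 xs k)

length-kSubsets : ∀ n k → length (kSubsets n k) ≡ binom n k
length-kSubsets n k = begin
  length (kSubsets n k)              ≡⟨ sym (trans (lsum-const 1 (kSubsets n k)) (ℕₚ.*-identityʳ _)) ⟩
  lsum (λ _ → 1) (kSubsets n k)      ≡⟨ lsum-kSubsets (Vec.allFin n) k (λ _ → 1) ⟩
  subΣ (Vec.toList (Vec.allFin n)) k (λ _ → 1)
    ≡⟨ subΣ-1 (Vec.toList (Vec.allFin n)) k ⟩
  binom (length (Vec.toList (Vec.allFin n))) k ≡⟨ cong (λ m → binom m k) (Vecₚ.length-toList (Vec.allFin n)) ⟩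
  binom n k ∎
  where open ≡-Reasoning

0<binom : ∀ {n k} → k ≤ n → 0 < binom n k
0<binom {zero}  z≤n       = s≤s z≤n
0<binom {suc n} z≤n       = 0<binom {n} z≤n
0<binom {suc n} {suc k} (s≤s k≤n) = ℕₚ.≤-trans (0<binom k≤n) (ℕₚ.m≤n+m _ (binom n (suc k)))

kSubsets-nonZero : ∀ {n k} → k ≤ n → NonZero (length (kSubsets n k))
kSubsets-nonZero {n} {k} k≤n =
  ℕ.>-nonZero (subst (0 <_) (sym (length-kSubsets n k)) (0<binom k≤n))

hits : ∀ {n} → Graph n → ℕ → ℕ → ℕ
hits {n} G k ℓ = length (filter (λ A → e G A ℕₚ.≟ ℓ) (kSubsets n k))

-- P(X_{G,k} = ℓ) for a uniformly random k-subset
prob : ∀ {n} → Graph n → (k ℓ : ℕ) → .(k ≤ n) → ℚ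
prob {n} G k ℓ k≤n = (+ hits G k ℓ / length (kSubsets n k)) {{kSubsets-nonZero k≤n}}

-- The graph on n + 1 vertices in which vertex 0 has neighbourhood N and the
-- others induce G.
addVertex : ∀ {n} → Subset n → Graph n → Graph (suc n)
addVertex {n} N G = record { adj = E ; adj-sym = E-sym ; adj-irrefl = E-irrefl }
  where
  E : Fin (suc n) → Fin (suc n) → Bool
  E zero    zero    = false
  E zero    (suc j) = lookup N j
  E (suc i) zero    = lookup N i
  E (suc i) (suc j) = adj G i j
  E-sym : ∀ i j → E i j ≡ E j i
  E-sym zero    zero    = refl
  E-sym zero    (suc j) = refl
  E-sym (suc i) zero    = refl
  E-sym (suc i) (suc j) = adj-sym G i j
  E-irrefl : ∀ i → E i i ≡ false
  E-irrefl zero    = refl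
  E-irrefl (suc i) = adj-irrefl G i

graphs : ∀ n → List (Graph n)
graphs zero    = record { adj = λ () ; adj-sym = λ () ; adj-irrefl = λ () } ∷ []
graphs (suc n) = cartesianProductWith addVertex (subsets n) (graphs n)

-- All probabilities are nonnegative and the list of graphs is nonempty, so the
-- default value 0 does not affect the maximum: see prob≤I and I-attained.
I : (n k ℓ : ℕ) → .(k ≤ n) → ℚ
I n k ℓ k≤n = max 0ℚ (map (λ G → prob G k ℓ k≤n) (graphs n))

∈-subsets : ∀ {n} (A : Subset n) → A ∈ subsets n
∈-subsets []          = here refl
∈-subsets (false ∷ A) = ∈-++⁺ˡ (∈-map⁺ (outside ∷_) (∈-subsets A))
∈-subsets {suc n} (true ∷ A) =
  ∈-++⁺ʳ (map (outside ∷_) (subsets n)) (∈-map⁺ (inside ∷_) (∈-subsets A))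

graphs-complete : ∀ {n} (G : Graph n) →
                  ∃[ H ] H ∈ graphs n × (∀ i j → adj G i j ≡ adj H i j)
graphs-complete {zero}  G = _ , here refl , λ ()
graphs-complete {suc n} G with graphs-complete G′
  where
  G′ : Graph n
  G′ = record { adj        = λ i j → adj G (suc i) (suc j)
              ; adj-sym    = λ i j → adj-sym G (suc i) (suc j)
              ; adj-irrefl = λ i → adj-irrefl G (suc i) }
... | H , H∈ , G≗H = addVertex N H , ∈-cartesianProductWith⁺ addVertex (∈-subsets N) H∈ , agree
  where
  N : Subset n
  N = tabulate (λ j → adj G zero (suc j))
  agree : ∀ i j → adj G i j ≡ adj (addVertex N H) i j
  agree zero    zero    = adj-irrefl G zero
  agree zero    (suc j) = sym (Vecₚ.lookup∘tabulate _ j)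
  agree (suc i) zero    = trans (adj-sym G (suc i) zero) (sym (Vecₚ.lookup∘tabulate _ i))
  agree (suc i) (suc j) = G≗H i j

edgesIn-cong : ∀ {n} {E F : Fin n → Fin n → Bool} → (∀ i j → E i j ≡ F i j) →
               ∀ A → edgesIn E A ≡ edgesIn F A
edgesIn-cong E≗F A = sum-cong-≗ λ i → sum-cong-≗ λ j →
  cong (λ b → 𝟙 ((toℕ i <ᵇ toℕ j) ∧ lookup A i ∧ lookup A j ∧ b)) (E≗F i j)

hits≡lsum : ∀ {n} (G : Graph n) k ℓ →
            hits G k ℓ ≡ lsum (λ A → 𝟙 (e G A ≡ᵇ ℓ)) (kSubsets n k)
hits≡lsum {n} G k ℓ = length-filter (λ A → e G A ℕₚ.≟ ℓ) (kSubsets n k)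

hits-cong : ∀ {n} (G H : Graph n) → (∀ i j → adj G i j ≡ adj H i j) →
            ∀ k ℓ → hits G k ℓ ≡ hits H k ℓ
hits-cong {n} G H G≗H k ℓ = trans (hits≡lsum G k ℓ) (trans
  (lsum-cong (λ A → cong (λ m → 𝟙 (m ≡ᵇ ℓ)) (edgesIn-cong G≗H A)) (kSubsets n k))
  (sym (hits≡lsum H k ℓ)))

0≤prob : ∀ {n} (G : Graph n) k ℓ (k≤n : k ≤ n) → 0ℚ ℚ.≤ prob G k ℓ k≤n
0≤prob {n} G k ℓ k≤n = ℚₚ.nonNegative⁻¹ _
  {{ℚₚ.normalize-nonNeg (hits G k ℓ) (length (kSubsets n k)) {{kSubsets-nonZero k≤n}}}}

prob-cong : ∀ {n} (G H : Graph n) → (∀ i j → adj G i j ≡ adj H i j) →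
            ∀ k ℓ (k≤n : k ≤ n) → prob G k ℓ k≤n ≡ prob H k ℓ k≤n
prob-cong {n} G H G≗H k ℓ k≤n =
  cong (λ c → (+ c / length (kSubsets n k)) {{kSubsets-nonZero k≤n}}) (hits-cong G H G≗H k ℓ)

module _ (n k ℓ : ℕ) (k≤n : k ≤ n) where

  probs : List ℚ
  probs = map (λ G → prob G k ℓ k≤n) (graphs n)

  prob≤I : ∀ G → prob G k ℓ k≤n ℚ.≤ I n k ℓ k≤n
  prob≤I G = listed (graphs-complete G)
    where
    listed : (∃[ H ] H ∈ graphs n × (∀ i j → adj G i j ≡ adj H i j)) →
             prob G k ℓ k≤n ℚ.≤ I n k ℓ k≤n
    listed (H , H∈ , G≗H) = subst (ℚ._≤ I n k ℓ k≤n) (sym (prob-cong G H G≗H k ℓ k≤n))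
      (All.lookup (xs≤max 0ℚ probs) (∈-map⁺ (λ F → prob F k ℓ k≤n) H∈))

  I-attained : ∃[ G ] I n k ℓ k≤n ≡ prob G k ℓ k≤n
  I-attained = attained (argmax-sel id 0ℚ probs)
    where
    noEdges : Graph n
    noEdges = record { adj = λ _ _ → false ; adj-sym = λ _ _ → refl ; adj-irrefl = λ _ → refl }
    attained : (I n k ℓ k≤n ≡ 0ℚ) ⊎ (I n k ℓ k≤n ∈ probs) → ∃[ G ] I n k ℓ k≤n ≡ prob G k ℓ k≤n
    attained (inj₁ I≡0) = noEdges , ℚₚ.≤-antisym
      (subst (ℚ._≤ prob noEdges k ℓ k≤n) (sym I≡0) (0≤prob noEdges k ℓ k≤n)) (prob≤I noEdges)
    attained (inj₂ I∈) = found (∈-map⁻ (λ G → prob G k ℓ k≤n) I∈)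
      where
      found : (∃[ G ] G ∈ graphs n × I n k ℓ k≤n ≡ prob G k ℓ k≤n) →
              ∃[ G ] I n k ℓ k≤n ≡ prob G k ℓ k≤n
      found (G , _ , eq) = G , eq

-- For G on n vertices, the graphs pull G φ over all maps φ from m vertices to
-- the vertices of G contain, on average, almost as large a proportion of
-- k-subsets spanning ℓ edges as G does.  Hence I(n,k,ℓ) ≤ I(m,k,ℓ) + k²/n for
-- all m ≥ k, which makes n ↦ I(n,k,ℓ) a Cauchy sequence.

-- Sum of g over all k-tuples with entries in us.
tupΣ : ∀ {X : Set} → List X → ℕ → (List X → ℕ) → ℕ
tupΣ us zero    g = g []
tupΣ us (suc k) g = lsum (λ u → tupΣ us k (g ∘ (u ∷_))) us

vecΣ : ∀ {X : Set} → List X → ∀ m → (Vec X m → ℕ) → ℕ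
vecΣ us zero    f = f []
vecΣ us (suc m) f = lsum (λ u → vecΣ us m (f ∘ (u ∷_))) us

vecΣ-+ : ∀ {X : Set} (us : List X) m f g →
         vecΣ us m (λ φ → f φ + g φ) ≡ vecΣ us m f + vecΣ us m g
vecΣ-+ us zero    f g = refl
vecΣ-+ us (suc m) f g =
  trans (lsum-cong (λ u → vecΣ-+ us m (f ∘ (u ∷_)) (g ∘ (u ∷_))) us) (lsum-+ _ _ us)

vecΣ-≤ : ∀ {X : Set} (us : List X) m f c → (∀ φ → f φ ≤ c) → vecΣ us m f ≤ length us ^ m * c
vecΣ-≤ us zero    f c f≤c = ℕₚ.≤-trans (f≤c []) (ℕₚ.≤-reflexive (sym (ℕₚ.+-identityʳ c)))
vecΣ-≤ us (suc m) f c f≤c = begin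
  lsum (λ u → vecΣ us m (f ∘ (u ∷_))) us
    ≤⟨ lsum-mono (λ u → vecΣ-≤ us m (f ∘ (u ∷_)) c (λ φ → f≤c (u ∷ φ))) us ⟩
  lsum (λ _ → length us ^ m * c) us  ≡⟨ lsum-const _ us ⟩
  length us * (length us ^ m * c)    ≡⟨ sym (ℕₚ.*-assoc (length us) _ c) ⟩
  length us ^ suc m * c              ∎
  where open ℕₚ.≤-Reasoning

averaging : ∀ {X : Set} (us : List X) m k g →
  length us ^ k * vecΣ us m (λ φ → subΣ (Vec.toList φ) k g)
    ≡ length us ^ m * binom m k * tupΣ us k g
averaging us zero    zero    g = refl
averaging us zero    (suc k) g = ℕₚ.*-zeroʳ (length us ^ suc k)
averaging us (suc m) zero    g = begin
  1 * lsum (λ _ → V) us              ≡⟨ cong (1 *_) (lsum-const V us) ⟩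
  1 * (N * V)                        ≡⟨ rearrange₁ N V ⟩
  N * (1 * V)                        ≡⟨ cong (N *_) (averaging us m zero g) ⟩
  N * (N ^ m * binom m zero * g [])  ≡⟨ rearrange₂ N (N ^ m) (binom m zero) (g []) ⟩
  N ^ suc m * binom m zero * g []    ∎
  where
  open ≡-Reasoning
  N = length us
  V = vecΣ us m (λ φ → subΣ (Vec.toList φ) zero g)
  rearrange₁ : ∀ a b → 1 * (a * b) ≡ a * (1 * b)
  rearrange₁ = solve 2 (λ a b →
    con 1 :* (a :* b) := a :* (con 1 :* b)) refl
  rearrange₂ : ∀ a b c d → a * (b * c * d) ≡ a * b * c * d
  rearrange₂ = solve 4 (λ a b c d →
    a :* (b :* c :* d) := a :* b :* c :* d) refl
averaging us (suc m) (suc k) g = begin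
  N ^ suc k * lsum (λ u → vecΣ us m (λ φ → subΣ (Vec.toList φ) (suc k) g + subΣ (Vec.toList φ) k (g ∘ (u ∷_)))) us
    ≡⟨ cong (N ^ suc k *_) (trans (lsum-cong (λ u → vecΣ-+ us m _ _) us) (lsum-+ (λ _ → V) W us)) ⟩
  N ^ suc k * (lsum (λ _ → V) us + lsum W us)
    ≡⟨ cong (λ z → N ^ suc k * (z + lsum W us)) (lsum-const V us) ⟩
  N ^ suc k * (N * V + lsum W us)
    ≡⟨ rearrange₁ N (N ^ k) V (lsum W us) ⟩
  N * (N ^ suc k * V) + N * (N ^ k * lsum W us)
    ≡⟨ cong₂ (λ y z → N * y + N * z) (averaging us m (suc k) g)
         (trans (sym (lsum-* (N ^ k) W us))
           (trans (lsum-cong (λ u → averaging us m k (g ∘ (u ∷_))) us)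
                  (lsum-* (N ^ m * binom m k) _ us))) ⟩
  N * (N ^ m * binom m (suc k) * t) + N * (N ^ m * binom m k * t)
    ≡⟨ rearrange₂ N (N ^ m) (binom m (suc k)) (binom m k) t ⟩
  N ^ suc m * (binom m (suc k) + binom m k) * t ∎
  where
  open ≡-Reasoning
  N = length us
  V = vecΣ us m (λ φ → subΣ (Vec.toList φ) (suc k) g)
  W = λ u → vecΣ us m (λ φ → subΣ (Vec.toList φ) k (g ∘ (u ∷_)))
  t = tupΣ us (suc k) g
  rearrange₁ : ∀ n p v w → (n * p) * (n * v + w) ≡ n * ((n * p) * v) + n * (p * w)
  rearrange₁ = solve 4 (λ n p v w →
    (n :* p) :* (n :* v :+ w) := n :* ((n :* p) :* v) :+ n :* (p :* w)) refl
  rearrange₂ : ∀ n p a b t → n * (p * a * t) + n * (p * b * t) ≡ n * p * (a + b) * t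
  rearrange₂ = solve 5 (λ n p a b t →
    n :* (p :* a :* t) :+ n :* (p :* b :* t) := n :* p :* (a :+ b) :* t) refl

Symmetric↭ : ∀ {X : Set} → (List X → ℕ) → Set
Symmetric↭ g = ∀ {xs ys} → xs ↭ ys → g xs ≡ g ys

tupΣ-cong : ∀ {X : Set} (us : List X) k {g h} → (∀ xs → g xs ≡ h xs) → tupΣ us k g ≡ tupΣ us k h
tupΣ-cong us zero    g≗h = g≗h []
tupΣ-cong us (suc k) g≗h = lsum-cong (λ u → tupΣ-cong us k (λ xs → g≗h (u ∷ xs))) us

tupΣ-weaken : ∀ {X : Set} (x : X) xs k g → tupΣ xs k g ≤ tupΣ (x ∷ xs) k g
tupΣ-weaken x xs zero    g = ℕₚ.≤-refl
tupΣ-weaken x xs (suc k) g = ℕₚ.≤-trans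
  (lsum-mono (λ y → tupΣ-weaken x xs k (g ∘ (y ∷_))) xs) (ℕₚ.m≤n+m _ _)

tupΣ-∷ : ∀ {X : Set} (x : X) xs k g → Symmetric↭ g →
  tupΣ xs (suc k) g + suc k * tupΣ xs k (g ∘ (x ∷_)) ≤ tupΣ (x ∷ xs) (suc k) g
tupΣ-∷ x xs zero g g-sym = ℕₚ.≤-reflexive (commute (lsum (λ y → g (y ∷ [])) xs) (g (x ∷ [])))
  where
  commute : ∀ a b → a + 1 * b ≡ b + a
  commute = solve 2 (λ a b →
    a :+ con 1 :* b := b :+ a) refl
tupΣ-∷ x xs (suc k) g g-sym = begin
  tupΣ xs (suc (suc k)) g + suc (suc k) * T
    ≡⟨ rearrange (tupΣ xs (suc (suc k)) g) k T ⟩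
  T + (tupΣ xs (suc (suc k)) g + suc k * T)
    ≡⟨ cong (λ z → T + (tupΣ xs (suc (suc k)) g + suc k * z))
         (lsum-cong (λ y → tupΣ-cong xs k (λ zs → g-sym (swap x y Perm.refl))) xs) ⟩
  T + (tupΣ xs (suc (suc k)) g + suc k * lsum (λ y → tupΣ xs k (g ∘ (y ∷_) ∘ (x ∷_))) xs)
    ≡⟨ cong (λ z → T + (tupΣ xs (suc (suc k)) g + z)) (sym (lsum-* (suc k) _ xs)) ⟩
  T + (tupΣ xs (suc (suc k)) g + lsum (λ y → suc k * tupΣ xs k (g ∘ (y ∷_) ∘ (x ∷_))) xs)
    ≡⟨ cong (_+_ T) (sym (lsum-+ _ _ xs)) ⟩
  T + lsum (λ y → tupΣ xs (suc k) (g ∘ (y ∷_)) + suc k * tupΣ xs k (g ∘ (y ∷_) ∘ (x ∷_))) xs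
    ≤⟨ ℕₚ.+-mono-≤ (tupΣ-weaken x xs (suc k) (g ∘ (x ∷_)))
         (lsum-mono (λ y → tupΣ-∷ x xs k (g ∘ (y ∷_)) (λ p → g-sym (prep y p))) xs) ⟩
  tupΣ (x ∷ xs) (suc (suc k)) g ∎
  where
  open ℕₚ.≤-Reasoning
  T = tupΣ xs (suc k) (g ∘ (x ∷_))
  rearrange : ∀ a k t → a + suc (suc k) * t ≡ t + (a + suc k * t)
  rearrange = solve 3 (λ a k t →
    a :+ (con 2 :+ k) :* t := t :+ (a :+ (con 1 :+ k) :* t)) refl

subΣ≤tupΣ : ∀ {X : Set} (xs : List X) k g → Symmetric↭ g → k ! * subΣ xs k g ≤ tupΣ xs k g
subΣ≤tupΣ []       zero    g g-sym = ℕₚ.≤-reflexive (ℕₚ.+-identityʳ (g []))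
subΣ≤tupΣ []       (suc k) g g-sym = ℕₚ.≤-reflexive (ℕₚ.*-zeroʳ (suc k !))
subΣ≤tupΣ (x ∷ xs) zero    g g-sym = subΣ≤tupΣ xs zero g g-sym
subΣ≤tupΣ (x ∷ xs) (suc k) g g-sym = begin
  suc k ! * (subΣ xs (suc k) g + subΣ xs k (g ∘ (x ∷_)))
    ≡⟨ rearrange k (k !) (subΣ xs (suc k) g) (subΣ xs k (g ∘ (x ∷_))) ⟩
  suc k ! * subΣ xs (suc k) g + suc k * (k ! * subΣ xs k (g ∘ (x ∷_)))
    ≤⟨ ℕₚ.+-mono-≤ (subΣ≤tupΣ xs (suc k) g g-sym)
         (ℕₚ.*-monoʳ-≤ (suc k) (subΣ≤tupΣ xs k (g ∘ (x ∷_)) (λ p → g-sym (prep x p)))) ⟩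
  tupΣ xs (suc k) g + suc k * tupΣ xs k (g ∘ (x ∷_))
    ≤⟨ tupΣ-∷ x xs k g g-sym ⟩
  tupΣ (x ∷ xs) (suc k) g ∎
  where
  open ℕₚ.≤-Reasoning
  rearrange : ∀ k f a b → (suc k * f) * (a + b) ≡ (suc k * f) * a + suc k * (f * b)
  rearrange = solve 4 (λ k f a b →
    ((con 1 :+ k) :* f) :* (a :+ b) := ((con 1 :+ k) :* f) :* a :+ (con 1 :+ k) :* (f :* b)) refl

binom-absorb : ∀ n k → suc k * binom n (suc k) + k * binom n k ≡ n * binom n k
binom-absorb zero    zero    = refl
binom-absorb zero    (suc k) = trans (cong₂ _+_ (ℕₚ.*-zeroʳ (suc (suc k))) (ℕₚ.*-zeroʳ (suc k))) refl
binom-absorb (suc n) zero    = begin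
  1 * (binom n 1 + binom n 0) + 0               ≡⟨ rearrange (binom n 1) (binom n 0) ⟩
  binom n 0 + (1 * binom n 1 + 0 * binom n 0)   ≡⟨ cong (_+_ (binom n 0)) (binom-absorb n zero) ⟩
  suc n * binom n 0                             ∎
  where
  open ≡-Reasoning
  rearrange : ∀ a b → 1 * (a + b) + 0 ≡ b + (1 * a + 0 * b)
  rearrange = solve 2 (λ a b →
    con 1 :* (a :+ b) :+ con 0 := b :+ (con 1 :* a :+ con 0 :* b)) refl
binom-absorb (suc n) (suc k) = begin
  suc (suc k) * (c + b) + suc k * (b + a)
    ≡⟨ rearrange₁ k a b c ⟩
  b + a + (suc (suc k) * c + suc k * b) + (suc k * b + k * a)
    ≡⟨ cong₂ (λ y z → b + a + y + z) (binom-absorb n (suc k)) (binom-absorb n k) ⟩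
  b + a + n * b + n * a
    ≡⟨ rearrange₂ n a b ⟩
  suc n * (b + a) ∎
  where
  open ≡-Reasoning
  a = binom n k
  b = binom n (suc k)
  c = binom n (suc (suc k))
  rearrange₁ : ∀ k a b c → suc (suc k) * (c + b) + suc k * (b + a)
                         ≡ b + a + (suc (suc k) * c + suc k * b) + (suc k * b + k * a)
  rearrange₁ = solve 4 (λ k a b c →
    (con 2 :+ k) :* (c :+ b) :+ (con 1 :+ k) :* (b :+ a) := b :+ a :+ ((con 2 :+ k) :* c :+ (con 1 :+ k) :* b) :+ ((con 1 :+ k) :* b :+ k :* a)) refl
  rearrange₂ : ∀ n a b → b + a + n * b + n * a ≡ suc n * (b + a)
  rearrange₂ = solve 3 (λ n a b →
    b :+ a :+ n :* b :+ n :* a := (con 1 :+ n) :* (b :+ a)) refl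

-- k! C(n,k), the falling factorial of n
falling-step : ∀ n k → suc k ! * binom n (suc k) + k * (k ! * binom n k) ≡ n * (k ! * binom n k)
falling-step n k = begin
  suc k ! * binom n (suc k) + k * (k ! * binom n k)     ≡⟨ rearrange k (k !) (binom n (suc k)) (binom n k) ⟩
  k ! * (suc k * binom n (suc k) + k * binom n k)       ≡⟨ cong (k ! *_) (binom-absorb n k) ⟩
  k ! * (n * binom n k)                                 ≡⟨ swap* (k !) n (binom n k) ⟩
  n * (k ! * binom n k)                                 ∎
  where
  open ≡-Reasoning
  rearrange : ∀ k f b a → suc k * f * b + k * (f * a) ≡ f * (suc k * b + k * a)
  rearrange = solve 4 (λ k f b a →
    (con 1 :+ k) :* f :* b :+ k :* (f :* a) := f :* ((con 1 :+ k) :* b :+ k :* a)) refl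
  swap* : ∀ f n a → f * (n * a) ≡ n * (f * a)
  swap* = solve 3 (λ f n a →
    f :* (n :* a) := n :* (f :* a)) refl

falling≤^ : ∀ n k → k ! * binom n k ≤ n ^ k
falling≤^ zero    zero    = ℕₚ.≤-refl
falling≤^ (suc n) zero    = falling≤^ n zero
falling≤^ n       (suc k) = begin
  suc k ! * binom n (suc k)                          ≤⟨ ℕₚ.m≤m+n _ _ ⟩
  suc k ! * binom n (suc k) + k * (k ! * binom n k)  ≡⟨ falling-step n k ⟩
  n * (k ! * binom n k)                              ≤⟨ ℕₚ.*-monoʳ-≤ n (falling≤^ n k) ⟩
  n ^ suc k                                          ∎
  where open ℕₚ.≤-Reasoning

binom-0 : ∀ n → binom n 0 ≡ 1
binom-0 zero    = refl
binom-0 (suc n) = binom-0 n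

^≤falling : ∀ n k → n * n ^ k ≤ n * (k ! * binom n k) + k * k * n ^ k
^≤falling n zero    = ℕₚ.≤-reflexive (trans (cong (λ b → n * (1 * b)) (sym (binom-0 n))) (sym (ℕₚ.+-identityʳ _)))
^≤falling n (suc k) = begin
  n * (n * P)                                       ≤⟨ ℕₚ.*-monoʳ-≤ n (^≤falling n k) ⟩
  n * (n * a + k * k * P)                           ≡⟨ cong (λ z → n * (z + k * k * P)) (sym (falling-step n k)) ⟩
  n * (b + k * a + k * k * P)                       ≤⟨ ℕₚ.*-monoʳ-≤ n (ℕₚ.+-monoˡ-≤ (k * k * P) (ℕₚ.+-monoʳ-≤ b (ℕₚ.*-monoʳ-≤ k (falling≤^ n k)))) ⟩
  n * (b + k * P + k * k * P)                       ≤⟨ ℕₚ.m≤m+n _ (suc k * (n * P)) ⟩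
  n * (b + k * P + k * k * P) + suc k * (n * P)     ≡⟨ rearrange n b k P ⟩
  n * b + suc k * suc k * (n * P)                   ∎
  where
  open ℕₚ.≤-Reasoning
  P = n ^ k
  a = k ! * binom n k
  b = suc k ! * binom n (suc k)
  rearrange : ∀ n b k P → n * (b + k * P + k * k * P) + suc k * (n * P) ≡ n * b + suc k * suc k * (n * P)
  rearrange = solve 4 (λ n b k P →
    n :* (b :+ k :* P :+ k :* k :* P) :+ (con 1 :+ k) :* (n :* P) := n :* b :+ (con 1 :+ k) :* (con 1 :+ k) :* (n :* P)) refl

-- Edges spanned by a list of vertices, counted with multiplicity.
edgesL : ∀ {X : Set} → (X → X → Bool) → List X → ℕ
edgesL E []       = 0
edgesL E (x ∷ xs) = lsum (𝟙 ∘ E x) xs + edgesL E xs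

sum-0 : ∀ n → sum {n} (λ _ → 0) ≡ 0
sum-0 zero    = refl
sum-0 (suc n) = sum-0 n

degree-elems : ∀ {X : Set} {m} (p : X → Bool) (A : Subset m) (φ : Vec X m) →
  ∑[ j < m ] 𝟙 (lookup A j ∧ p (lookup φ j)) ≡ lsum (𝟙 ∘ p) (elems A φ)
degree-elems p []          []      = refl
degree-elems p (true  ∷ A) (x ∷ φ) = cong (_+_ (𝟙 (p x))) (degree-elems p A φ)
degree-elems p (false ∷ A) (x ∷ φ) = degree-elems p A φ

edgesIn-elems : ∀ {X : Set} {m} (E : X → X → Bool) (A : Subset m) (φ : Vec X m) →
  edgesIn (λ i j → E (lookup φ i) (lookup φ j)) A ≡ edgesL E (elems A φ)
edgesIn-elems E []          []      = refl
edgesIn-elems E (true  ∷ A) (x ∷ φ) = cong₂ _+_ (degree-elems (E x) A φ) (edgesIn-elems E A φ)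
edgesIn-elems {m = suc m} E (false ∷ A) (x ∷ φ) = cong₂ _+_ (sum-0 m) (edgesIn-elems E A φ)

lsum-↭ : ∀ {X : Set} (f : X → ℕ) {xs ys} → xs ↭ ys → lsum f xs ≡ lsum f ys
lsum-↭ f Perm.refl       = refl
lsum-↭ f (prep x p)      = cong (_+_ (f x)) (lsum-↭ f p)
lsum-↭ f (swap x y p)    = trans (rearrange (f x) (f y) _) (cong (λ z → f y + (f x + z)) (lsum-↭ f p))
  where
  rearrange : ∀ a b c → a + (b + c) ≡ b + (a + c)
  rearrange = solve 3 (λ a b c →
    a :+ (b :+ c) := b :+ (a :+ c)) refl
lsum-↭ f (Perm.trans p q) = trans (lsum-↭ f p) (lsum-↭ f q)

edgesL-↭ : ∀ {X : Set} (E : X → X → Bool) → (∀ x y → E x y ≡ E y x) → Symmetric↭ (edgesL E)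
edgesL-↭ E E-sym Perm.refl  = refl
edgesL-↭ E E-sym (prep x p) = cong₂ _+_ (lsum-↭ (𝟙 ∘ E x) p) (edgesL-↭ E E-sym p)
edgesL-↭ E E-sym (swap {xs} {ys} x y p) = begin
  𝟙 (E x y) + lsum (𝟙 ∘ E x) xs + (lsum (𝟙 ∘ E y) xs + edgesL E xs)
    ≡⟨ cong (λ b → 𝟙 b + lsum (𝟙 ∘ E x) xs + (lsum (𝟙 ∘ E y) xs + edgesL E xs)) (E-sym x y) ⟩
  𝟙 (E y x) + lsum (𝟙 ∘ E x) xs + (lsum (𝟙 ∘ E y) xs + edgesL E xs)
    ≡⟨ rearrange (𝟙 (E y x)) _ _ _ ⟩
  𝟙 (E y x) + lsum (𝟙 ∘ E y) xs + (lsum (𝟙 ∘ E x) xs + edgesL E xs)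
    ≡⟨ cong₂ _+_ (cong (_+_ (𝟙 (E y x))) (lsum-↭ (𝟙 ∘ E y) p))
                 (cong₂ _+_ (lsum-↭ (𝟙 ∘ E x) p) (edgesL-↭ E E-sym p)) ⟩
  𝟙 (E y x) + lsum (𝟙 ∘ E y) ys + (lsum (𝟙 ∘ E x) ys + edgesL E ys) ∎
  where
  open ≡-Reasoning
  rearrange : ∀ a b c d → a + b + (c + d) ≡ a + c + (b + d)
  rearrange = solve 4 (λ a b c d →
    a :+ b :+ (c :+ d) := a :+ c :+ (b :+ d)) refl
edgesL-↭ E E-sym (Perm.trans p q) = trans (edgesL-↭ E E-sym p) (edgesL-↭ E E-sym q)

pull : ∀ {n m} → Graph n → Vec (Fin n) m → Graph m
pull G φ = record
  { adj        = λ i j → adj G (lookup φ i) (lookup φ j)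
  ; adj-sym    = λ i j → adj-sym G (lookup φ i) (lookup φ j)
  ; adj-irrefl = λ i → adj-irrefl G (lookup φ i) }

spans : ∀ {n} → Graph n → ℕ → List (Fin n) → ℕ
spans G ℓ xs = 𝟙 (edgesL (adj G) xs ≡ᵇ ℓ)

hits-pull : ∀ {n m} (G : Graph n) (φ : Vec (Fin n) m) k ℓ →
            hits (pull G φ) k ℓ ≡ subΣ (Vec.toList φ) k (spans G ℓ)
hits-pull {m = m} G φ k ℓ = trans (hits≡lsum (pull G φ) k ℓ) (trans
  (lsum-cong (λ A → cong (λ c → 𝟙 (c ≡ᵇ ℓ)) (edgesIn-elems (adj G) A φ)) (kSubsets m k))
  (lsum-kSubsets φ k (spans G ℓ)))

hits-allFin : ∀ {n} (G : Graph n) k ℓ →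
              hits G k ℓ ≡ subΣ (Vec.toList (Vec.allFin n)) k (spans G ℓ)
hits-allFin {n} G k ℓ = trans
  (hits-cong G (pull G (Vec.allFin n))
    (λ i j → sym (cong₂ (adj G) (Vecₚ.lookup-allFin i) (Vecₚ.lookup-allFin j))) k ℓ)
  (hits-pull G (Vec.allFin n) k ℓ)

hits≤kSubsets : ∀ {n} (G : Graph n) k ℓ → hits G k ℓ ≤ length (kSubsets n k)
hits≤kSubsets {n} G k ℓ = Listₚ.length-filter (λ A → e G A ℕₚ.≟ ℓ) (kSubsets n k)

hits-compare : ∀ {n m} → 0 < n → (G : Graph n) → ∀ k ℓ c → (∀ (H : Graph m) → hits H k ℓ ≤ c) →
  k ! * hits G k ℓ * length (kSubsets m k) ≤ n ^ k * c
hits-compare {n@(suc _)} {m} _ G k ℓ c hits≤c =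
  ℕₚ.*-cancelˡ-≤ (n ^ m) {{ℕₚ.m^n≢0 n m}} (begin
    n ^ m * (k ! * hits G k ℓ * length (kSubsets m k))
      ≡⟨ cong₂ (λ y z → n ^ m * (k ! * y * z)) (hits-allFin G k ℓ) (length-kSubsets m k) ⟩
    n ^ m * (k ! * subΣ us k (spans G ℓ) * binom m k)
      ≤⟨ ℕₚ.*-monoʳ-≤ (n ^ m) (ℕₚ.*-monoˡ-≤ (binom m k) (subΣ≤tupΣ us k (spans G ℓ)
           (λ p → cong (λ z → 𝟙 (z ≡ᵇ ℓ)) (edgesL-↭ (adj G) (adj-sym G) p)))) ⟩
    n ^ m * (tupΣ us k (spans G ℓ) * binom m k)
      ≡⟨ rearrange₁ (n ^ m) (tupΣ us k (spans G ℓ)) (binom m k) ⟩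
    n ^ m * binom m k * tupΣ us k (spans G ℓ)
      ≡⟨ subst (λ N → N ^ m * binom m k * tupΣ us k (spans G ℓ) ≡ N ^ k * V)
               (Vecₚ.length-toList (Vec.allFin n)) (sym (averaging us m k (spans G ℓ))) ⟩
    n ^ k * V
      ≤⟨ ℕₚ.*-monoʳ-≤ (n ^ k) (subst (λ N → V ≤ N ^ m * c) (Vecₚ.length-toList (Vec.allFin n))
           (vecΣ-≤ us m _ c (λ φ → subst (_≤ c) (hits-pull G φ k ℓ) (hits≤c (pull G φ))))) ⟩
    n ^ k * (n ^ m * c)
      ≡⟨ rearrange₂ (n ^ k) (n ^ m) c ⟩
    n ^ m * (n ^ k * c) ∎)
  where
  open ℕₚ.≤-Reasoning
  us = Vec.toList (Vec.allFin n)
  V = vecΣ us m (λ φ → subΣ (Vec.toList φ) k (spans G ℓ))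
  rearrange₁ : ∀ a b c → a * (b * c) ≡ a * c * b
  rearrange₁ = solve 3 (λ a b c →
    a :* (b :* c) := a :* c :* b) refl
  rearrange₂ : ∀ a b c → a * (b * c) ≡ b * (a * c)
  rearrange₂ = solve 3 (λ a b c →
    a :* (b :* c) := b :* (a :* c)) refl

cross-multiply : ∀ n k f C C′ c c′ P → 0 < n → 0 < P → c ≤ C →
  f * c * C′ ≤ P * c′ → n * P ≤ n * (f * C) + k * k * P →
  n * (c * C′) ≤ (n * c′ + k * k * C′) * C
cross-multiply n k f C C′ c c′ P 0<n 0<P c≤C h₁ h₂ =
  ℕₚ.*-cancelˡ-≤ P {{ℕ.>-nonZero 0<P}} (begin
    P * (n * (c * C′))                                ≡⟨ rearrange₁ P n (c * C′) ⟩
    n * P * (c * C′)                                  ≤⟨ ℕₚ.*-monoˡ-≤ (c * C′) h₂ ⟩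
    (n * (f * C) + k * k * P) * (c * C′)              ≡⟨ rearrange₂ n f C k P c C′ ⟩
    n * C * (f * c * C′) + k * k * P * C′ * c         ≤⟨ ℕₚ.+-mono-≤ (ℕₚ.*-monoʳ-≤ (n * C) h₁) (ℕₚ.*-monoʳ-≤ (k * k * P * C′) c≤C) ⟩
    n * C * (P * c′) + k * k * P * C′ * C             ≡⟨ rearrange₃ n C P c′ k C′ ⟩
    P * ((n * c′ + k * k * C′) * C)                   ∎)
  where
  open ℕₚ.≤-Reasoning
  rearrange₁ : ∀ P n x → P * (n * x) ≡ n * P * x
  rearrange₁ = solve 3 (λ P n x →
    P :* (n :* x) := n :* P :* x) refl
  rearrange₂ : ∀ n f C k P c D → (n * (f * C) + k * k * P) * (c * D) ≡ n * C * (f * c * D) + k * k * P * D * c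
  rearrange₂ = solve 7 (λ n f C k P c D →
    (n :* (f :* C) :+ k :* k :* P) :* (c :* D) := n :* C :* (f :* c :* D) :+ k :* k :* P :* D :* c) refl
  rearrange₃ : ∀ n C P c k D → n * C * (P * c) + k * k * P * D * C ≡ P * ((n * c + k * k * D) * C)
  rearrange₃ = solve 6 (λ n C P c k D →
    n :* C :* (P :* c) :+ k :* k :* P :* D :* C := P :* ((n :* c :+ k :* k :* D) :* C)) refl

clear-ε : ∀ n K C C′ c c′ p q → 0 < n → K * suc q ≤ n →
  n * (c * C′) ≤ (n * c′ + K * C′) * C →
  c * (C′ * suc q) ≤ (c′ * suc q + suc p * C′) * C
clear-ε n K C C′ c c′ p q 0<n Kq≤n h =
  ℕₚ.*-cancelˡ-≤ n {{ℕ.>-nonZero 0<n}} (begin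
    n * (c * (C′ * suc q))                         ≡⟨ rearrange₁ n c C′ q ⟩
    suc q * (n * (c * C′))                         ≤⟨ ℕₚ.*-monoʳ-≤ (suc q) h ⟩
    suc q * ((n * c′ + K * C′) * C)                ≡⟨ rearrange₂ q n c′ K C′ C ⟩
    (n * (c′ * suc q) + K * suc q * C′) * C        ≤⟨ ℕₚ.*-monoˡ-≤ C (ℕₚ.+-monoʳ-≤ (n * (c′ * suc q)) (ℕₚ.*-monoˡ-≤ C′ Kq≤n)) ⟩
    (n * (c′ * suc q) + n * C′) * C                ≤⟨ ℕₚ.*-monoˡ-≤ C (ℕₚ.+-monoʳ-≤ (n * (c′ * suc q)) (ℕₚ.*-monoʳ-≤ n (ℕₚ.m≤m+n C′ (p * C′)))) ⟩
    (n * (c′ * suc q) + n * (suc p * C′)) * C      ≡⟨ rearrange₃ n c′ q p C′ C ⟩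
    n * ((c′ * suc q + suc p * C′) * C)            ∎)
  where
  open ℕₚ.≤-Reasoning
  rearrange₁ : ∀ n c D q → n * (c * (D * suc q)) ≡ suc q * (n * (c * D))
  rearrange₁ = solve 4 (λ n c D q →
    n :* (c :* (D :* (con 1 :+ q))) := (con 1 :+ q) :* (n :* (c :* D))) refl
  rearrange₂ : ∀ q n c K D C → suc q * ((n * c + K * D) * C) ≡ (n * (c * suc q) + K * suc q * D) * C
  rearrange₂ = solve 6 (λ q n c K D C →
    (con 1 :+ q) :* ((n :* c :+ K :* D) :* C) := (n :* (c :* (con 1 :+ q)) :+ K :* (con 1 :+ q) :* D) :* C) refl
  rearrange₃ : ∀ n c q p D C → (n * (c * suc q) + n * (suc p * D)) * C ≡ n * ((c * suc q + suc p * D) * C)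
  rearrange₃ = solve 6 (λ n c q p D C →
    (n :* (c :* (con 1 :+ q)) :+ n :* ((con 1 :+ p) :* D)) :* C := n :* ((c :* (con 1 :+ q) :+ (con 1 :+ p) :* D) :* C)) refl

/-cancel-≤ : ∀ a b d .{{_ : NonZero d}} → + a / d ℚ.≤ + b / d → a ≤ b
/-cancel-≤ a b d@(suc d-1) a/d≤b/d = ℕₚ.*-cancelʳ-≤ a b d
  (ℤₚ.drop‿+≤+ (subst₂ ℤ._≤_ (sym (ℤₚ.pos-* a d)) (sym (ℤₚ.pos-* b d)) (ℚᵘₚ.drop-*≤* (begin
    ℚᵘ.mkℚᵘ (+ a) d-1    ≃⟨ ℚₚ.toℚᵘ-fromℚᵘ (ℚᵘ.mkℚᵘ (+ a) d-1) ⟨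
    ℚ.toℚᵘ (+ a / d)     ≤⟨ ℚₚ.toℚᵘ-mono-≤ a/d≤b/d ⟩
    ℚ.toℚᵘ (+ b / d)     ≃⟨ ℚₚ.toℚᵘ-fromℚᵘ (ℚᵘ.mkℚᵘ (+ b) d-1) ⟩
    ℚᵘ.mkℚᵘ (+ b) d-1    ∎))))
  where open ℚᵘₚ.≤-Reasoning

/-≤-+ : ∀ a b c d p q .{{_ : NonZero b}} .{{_ : NonZero d}} .{cop : Coprime (suc p) (suc q)} →
  a * (d * suc q) ≤ (c * suc q + suc p * d) * b →
  + a / b ℚ.≤ + c / d ℚ.+ mkℚ +[1+ p ] q cop
/-≤-+ a b@(suc b-1) c d@(suc d-1) p q {cop = cop} h = ℚₚ.toℚᵘ-cancel-≤ (begin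
  ℚ.toℚᵘ (+ a / b)                                    ≃⟨ ℚₚ.toℚᵘ-fromℚᵘ (ℚᵘ.mkℚᵘ (+ a) b-1) ⟩
  ℚᵘ.mkℚᵘ (+ a) b-1                                   ≤⟨ ℚᵘ.*≤* (subst₂ ℤ._≤_ lhs rhs (ℤ.+≤+ h)) ⟩
  ℚᵘ.mkℚᵘ (+ c) d-1 ℚᵘ.+ ℚᵘ.mkℚᵘ +[1+ p ] q           ≃⟨ ℚᵘₚ.+-cong (ℚₚ.toℚᵘ-fromℚᵘ (ℚᵘ.mkℚᵘ (+ c) d-1)) ℚᵘₚ.≃-refl ⟨
  ℚ.toℚᵘ (+ c / d) ℚᵘ.+ ℚᵘ.mkℚᵘ +[1+ p ] q            ≃⟨ ℚₚ.toℚᵘ-homo-+ (+ c / d) (mkℚ +[1+ p ] q cop) ⟨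
  ℚ.toℚᵘ (+ c / d ℚ.+ mkℚ +[1+ p ] q cop)             ∎)
  where
  open ℚᵘₚ.≤-Reasoning
  lhs : + (a * (d * suc q)) ≡ + a ℤ.* + (d * suc q)
  lhs = ℤₚ.pos-* a (d * suc q)
  rhs : + ((c * suc q + suc p * d) * b) ≡ (+ c ℤ.* + suc q ℤ.+ + suc p ℤ.* + d) ℤ.* + b
  rhs = trans (ℤₚ.pos-* (c * suc q + suc p * d) b) (cong (ℤ._* + b)
    (trans (ℤₚ.pos-+ (c * suc q) (suc p * d)) (cong₂ ℤ._+_ (ℤₚ.pos-* c (suc q)) (ℤₚ.pos-* (suc p) d))))

I-≤-+ : ∀ k ℓ p q .(cop : Coprime (suc p) (suc q)) n m (k≤n : k ≤ n) (k≤m : k ≤ m) → k * k * suc q < n →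
  I n k ℓ k≤n ℚ.≤ I m k ℓ k≤m ℚ.+ mkℚ +[1+ p ] q cop
I-≤-+ k ℓ p q cop n m k≤n k≤m k²q<n = compare (I-attained n k ℓ k≤n) (I-attained m k ℓ k≤m)
  where
  C  = length (kSubsets n k)
  C′ = length (kSubsets m k)
  0<n : 0 < n
  0<n = ℕₚ.≤-<-trans z≤n k²q<n
  hits≤ : ∀ H → I m k ℓ k≤m ≡ prob H k ℓ k≤m → ∀ F → hits F k ℓ ≤ hits H k ℓ
  hits≤ H I≡H F = /-cancel-≤ (hits F k ℓ) (hits H k ℓ) C′ {{kSubsets-nonZero k≤m}}
    (subst (prob F k ℓ k≤m ℚ.≤_) I≡H (prob≤I m k ℓ k≤m F))
  compare : (∃[ G ] I n k ℓ k≤n ≡ prob G k ℓ k≤n) → (∃[ H ] I m k ℓ k≤m ≡ prob H k ℓ k≤m) →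
            I n k ℓ k≤n ℚ.≤ I m k ℓ k≤m ℚ.+ mkℚ +[1+ p ] q cop
  compare (G , I≡G) (H , I≡H) =
    subst₂ (λ x y → x ℚ.≤ y ℚ.+ mkℚ +[1+ p ] q cop) (sym I≡G) (sym I≡H)
      (/-≤-+ (hits G k ℓ) C (hits H k ℓ) C′ p q {{kSubsets-nonZero k≤n}} {{kSubsets-nonZero k≤m}}
        (clear-ε n (k * k) C C′ (hits G k ℓ) (hits H k ℓ) p q 0<n (ℕₚ.<⇒≤ k²q<n)
          (cross-multiply n k (k !) C C′ (hits G k ℓ) (hits H k ℓ) (n ^ k) 0<n
            (ℕₚ.m^n>0 n {{ℕ.>-nonZero 0<n}} k) (hits≤kSubsets G k ℓ)
            (hits-compare 0<n G k ℓ (hits H k ℓ) (hits≤ H I≡H))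
            (subst (λ b → n * n ^ k ≤ n * (k ! * b) + k * k * n ^ k) (sym (length-kSubsets n k))
              (^≤falling n k)))))

≤-+⇒-≤ : ∀ {x y ε} → x ℚ.≤ y ℚ.+ ε → x ℚ.- y ℚ.≤ ε
≤-+⇒-≤ {x} {y} {ε} x≤y+ε = ℚₚ.≤-trans (ℚₚ.+-monoˡ-≤ (ℚ.- y) x≤y+ε) (ℚₚ.≤-reflexive
  (trans (cong (ℚ._- y) (ℚₚ.+-comm y ε)) (//-rightDividesʳ y ε)))

∣-∣≤ : ∀ {x y ε} → x ℚ.≤ y ℚ.+ ε → y ℚ.≤ x ℚ.+ ε → ℚ.∣ x ℚ.- y ∣ ℚ.≤ ε
∣-∣≤ {x} {y} {ε} x≤y+ε y≤x+ε with ℚₚ.∣p∣≡p∨∣p∣≡-p (x ℚ.- y)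
... | inj₁ eq = ℚₚ.≤-trans (ℚₚ.≤-reflexive eq) (≤-+⇒-≤ x≤y+ε)
... | inj₂ eq = ℚₚ.≤-trans (ℚₚ.≤-reflexive (trans eq (⁻¹-anti-homo-// x y))) (≤-+⇒-≤ y≤x+ε)

-- A real number is given by a Cauchy sequence of rationals, of which it is the
-- limit.
record ℝ : Set where
  constructor lim
  field
    approx : ℕ → ℚ
    cauchy : ∀ ε → 0ℚ ℚ.< ε →
             ∃[ N ] ∀ m n → N ≤ m → N ≤ n → ℚ.∣ approx m ℚ.- approx n ∣ ℚ.≤ ε

open ℝ public

infix 4 _≤ᵣ_

_≤ᵣ_ : ℝ → ℝ → Set
x ≤ᵣ y = ∀ ε → 0ℚ ℚ.< ε → ∃[ N ] ∀ n → N ≤ n → approx x n ℚ.≤ approx y n ℚ.+ ε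

fromℚ : ℚ → ℝ
fromℚ q = lim (λ _ → q) λ ε 0<ε → 0 , λ _ _ _ _ →
  ∣-∣≤ (q≤q+ ε 0<ε) (q≤q+ ε 0<ε)
  where
  q≤q+ : ∀ ε → 0ℚ ℚ.< ε → q ℚ.≤ q ℚ.+ ε
  q≤q+ ε 0<ε = ℚₚ.≤-trans (ℚₚ.≤-reflexive (sym (ℚₚ.+-identityʳ q)))
                          (ℚₚ.+-monoʳ-≤ q (ℚₚ.<⇒≤ 0<ε))

-- I(n,k,ℓ) is defined only for n ≥ k, so the sequence is indexed by m = n − k.
I-seq : ℕ → ℕ → ℕ → ℚ
I-seq k ℓ m = I (k + m) k ℓ (ℕₚ.m≤m+n k m)

I-cauchy : ∀ k ℓ ε → 0ℚ ℚ.< ε →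
           ∃[ N ] ∀ m n → N ≤ m → N ≤ n → ℚ.∣ I-seq k ℓ m ℚ.- I-seq k ℓ n ∣ ℚ.≤ ε
I-cauchy k ℓ (mkℚ (+ zero) q _) (ℚ.*<* (ℤ.+<+ ()))
I-cauchy k ℓ (mkℚ -[1+ p ] q _) (ℚ.*<* ())
I-cauchy k ℓ (mkℚ +[1+ p ] q cop) 0<ε = suc (k * k * suc q) , λ m n N≤m N≤n →
  ∣-∣≤ (I-≤-+ k ℓ p q cop (k + m) (k + n) (ℕₚ.m≤m+n k m) (ℕₚ.m≤m+n k n) (ℕₚ.≤-trans N≤m (ℕₚ.m≤n+m m k)))
       (I-≤-+ k ℓ p q cop (k + n) (k + m) (ℕₚ.m≤m+n k n) (ℕₚ.m≤m+n k m) (ℕₚ.≤-trans N≤n (ℕₚ.m≤n+m n k)))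

-- The limit of I(n,k,ℓ) as n → ∞.  It is total in k and ℓ: when ℓ > C(k,2) every
-- term of the sequence is 0.
ind : ℕ → ℕ → ℝ
ind k ℓ = lim (I-seq k ℓ) (I-cauchy k ℓ)

{-# OPTIONS --safe #-}

-- The bound 1/2 + o(1) holds for every ℓ ≥ 1.  Sample vertices v₁, v₂, …
-- independently, let Xⱼ be the number of edges among the first j, and put
-- p = P(X_k = ℓ), q = P(X_{k-1} < ℓ), r = P(X_{k+1} > ℓ).  Given the first k − 1
-- vertices, with ℓ − d edges for some d > 0, let φ be d times the probability
-- that one more vertex has degree exactly d into them.  By the handshake lemma,
-- E φ = 2ℓp/k.  Two further vertices that both have degree d lead to more than ℓ
-- edges, and counting such pairs by degrees gives k(k+1) E φ² ≤ 16ℓ² r.  Since φ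
-- is supported on an event of probability q, Cauchy–Schwarz yields p² ≤ 4qr.
-- Finally q and r exceed P(X_k < ℓ) and P(X_k > ℓ) by O(ℓ/k) only, so that
-- q + p + r ≤ 1 + O(ℓ/k) and hence 2p ≤ 1 + O(ℓ/k).
module Submission where

open import Defs using (ind; fromℚ; _≤ᵣ_)
open import Data.Integer.Base using (+_)
open import Data.Nat.Base using (ℕ; _≤_; _<_)
open import Data.Product.Base using (_×_; ∃-syntax)
open import Data.Rational.Base using (ℚ; 0ℚ; _/_) renaming (_+_ to _+ℚ_; _<_ to _<ℚ_)

open import Defs
open import Data.Bool.Base using (Bool; true; false; T)
open import Data.Empty using (⊥-elim)
open import Data.Integer.Base using (+[1+_]; -[1+_]; +<+)
open import Data.List.Base using (List; []; _∷_; length)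
open import Data.List.Relation.Binary.Permutation.Propositional using (_↭_; prep; swap)
import Data.List.Relation.Binary.Permutation.Propositional as Perm
open import Data.Nat.Base
  using (zero; suc; NonZero; _+_; _*_; _^_; _∸_; _!; z≤n; z<s; _<ᵇ_; _≡ᵇ_; >-nonZero)
import Data.Nat.Base as ℕ
import Data.Nat.Properties as ℕₚ
open import Data.Nat.Tactic.RingSolver using (solve-∀)
open import Data.Product.Base using (_,_; proj₁; proj₂)
import Data.Rational.Base as ℚ
import Data.Rational.Properties as ℚₚ
open import Data.Sum.Base using (inj₁; inj₂)
open import Data.Unit.Base using (tt)
import Data.Vec.Base as Vec
import Data.Vec.Properties as Vecₚ
open import Function.Base using (_∘_)
open import Relation.Binary.PropositionalEquality
open import Relation.Nullary.Decidable using (from-yes)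

open ℕₚ.≤-Reasoning

-- The inequality of means and Cauchy-Schwarz in the natural numbers.

4uv≤[u+v]² : ∀ u v → 4 * (u * v) ≤ (u + v) * (u + v)
4uv≤[u+v]² u v with ℕₚ.≤-total u v
-- Ordering u and v makes their difference w a natural number, and the two sides differ by w².
... | inj₁ u≤v = subst (λ v → 4 * (u * v) ≤ (u + v) * (u + v)) (ℕₚ.m+[n∸m]≡n u≤v) (gap u (v ∸ u))
  where
  expand : ∀ u w → (u + (u + w)) * (u + (u + w)) ≡ 4 * (u * (u + w)) + w * w
  expand = solve-∀
  gap : ∀ u w → 4 * (u * (u + w)) ≤ (u + (u + w)) * (u + (u + w))
  gap u w = ℕₚ.≤-trans (ℕₚ.m≤m+n _ (w * w)) (ℕₚ.≤-reflexive (sym (expand u w)))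
... | inj₂ v≤u = subst (λ u → 4 * (u * v) ≤ (u + v) * (u + v)) (ℕₚ.m+[n∸m]≡n v≤u) (gap v (u ∸ v))
  where
  expand : ∀ v w → (v + w + v) * (v + w + v) ≡ 4 * ((v + w) * v) + w * w
  expand = solve-∀
  gap : ∀ v w → 4 * ((v + w) * v) ≤ (v + w + v) * (v + w + v)
  gap v w = ℕₚ.≤-trans (ℕₚ.m≤m+n _ (w * w)) (ℕₚ.≤-reflexive (sym (expand v w)))

x²≤uv⇒2x≤u+v : ∀ x u v → x * x ≤ u * v → 2 * x ≤ u + v
x²≤uv⇒2x≤u+v x u v x²≤uv = ℕₚ.≮⇒≥ λ u+v<2x → ℕₚ.<-irrefl refl (begin-strict
  (u + v) * (u + v)   <⟨ ℕₚ.*-mono-< u+v<2x u+v<2x ⟩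
  (2 * x) * (2 * x)   ≡⟨ square x ⟩
  4 * (x * x)         ≤⟨ ℕₚ.*-monoʳ-≤ 4 x²≤uv ⟩
  4 * (u * v)         ≤⟨ 4uv≤[u+v]² u v ⟩
  (u + v) * (u + v)   ∎)
  where
  square : ∀ x → (2 * x) * (2 * x) ≡ 4 * (x * x)
  square = solve-∀

-- The induction step for longer sums. Only the cross term needs an argument: (st)² is at most
-- (ad)(cb), so 2st is at most ad + cb by the inequality of means.
cauchy-schwarz₂ : ∀ s t a b c d → s * s ≤ a * b → t * t ≤ c * d →
                  (s + t) * (s + t) ≤ (a + c) * (b + d)
cauchy-schwarz₂ s t a b c d s²≤ab t²≤cd = begin
  (s + t) * (s + t)                    ≡⟨ expandˡ s t ⟩
  s * s + 2 * (s * t) + t * t          ≤⟨ ℕₚ.+-mono-≤ (ℕₚ.+-mono-≤ s²≤ab cross) t²≤cd ⟩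
  a * b + (a * d + c * b) + c * d      ≡⟨ expandʳ a b c d ⟩
  (a + c) * (b + d)                    ∎
  where
  expandˡ : ∀ s t → (s + t) * (s + t) ≡ s * s + 2 * (s * t) + t * t
  expandˡ = solve-∀
  expandʳ : ∀ a b c d → a * b + (a * d + c * b) + c * d ≡ (a + c) * (b + d)
  expandʳ = solve-∀
  regroup : ∀ s t → (s * t) * (s * t) ≡ (s * s) * (t * t)
  regroup = solve-∀
  exchange : ∀ a b c d → (a * b) * (c * d) ≡ (a * d) * (c * b)
  exchange = solve-∀
  cross : 2 * (s * t) ≤ a * d + c * b
  cross = x²≤uv⇒2x≤u+v (s * t) (a * d) (c * b) (begin
    (s * t) * (s * t)   ≡⟨ regroup s t ⟩
    (s * s) * (t * t)   ≤⟨ ℕₚ.*-mono-≤ s²≤ab t²≤cd ⟩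
    (a * b) * (c * d)   ≡⟨ exchange a b c d ⟩
    (a * d) * (c * b)   ∎)

-- Indicators of events.

𝟙*-≤ : ∀ b {x y} → (T b → x ≤ y) → 𝟙 b * x ≤ y
𝟙*-≤ true  x≤y = ℕₚ.≤-trans (ℕₚ.≤-reflexive (ℕₚ.+-identityʳ _)) (x≤y tt)
𝟙*-≤ false x≤y = z≤n

≤-𝟙* : ∀ b {x} → T b → x ≤ 𝟙 b * x
≤-𝟙* true _ = ℕₚ.m≤m+n _ 0

𝟙*-≤² : ∀ a b {x y z} → (T a → T b → x * y ≤ z) → (𝟙 a * x) * (𝟙 b * y) ≤ z
𝟙*-≤² true  true  {x} {y} xy≤z =
  ℕₚ.≤-trans (ℕₚ.≤-reflexive (cong₂ _*_ (ℕₚ.+-identityʳ x) (ℕₚ.+-identityʳ y))) (xy≤z tt tt)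
𝟙*-≤² true  false {x} xy≤z = ℕₚ.≤-trans (ℕₚ.≤-reflexive (ℕₚ.*-zeroʳ (x + 0))) z≤n
𝟙*-≤² false b     xy≤z = z≤n

<ᵇ-dichotomy : ∀ m n → 𝟙 (m <ᵇ n) + 𝟙 (n <ᵇ suc m) ≡ 1
<ᵇ-dichotomy zero    zero    = refl
<ᵇ-dichotomy zero    (suc n) = refl
<ᵇ-dichotomy (suc m) zero    = refl
<ᵇ-dichotomy (suc m) (suc n) = <ᵇ-dichotomy m n

<ᵇ-trichotomy : ∀ m n → 𝟙 (m <ᵇ n) + 𝟙 (m ≡ᵇ n) + 𝟙 (n <ᵇ m) ≡ 1
<ᵇ-trichotomy zero    zero    = refl
<ᵇ-trichotomy zero    (suc n) = refl
<ᵇ-trichotomy (suc m) zero    = refl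
<ᵇ-trichotomy (suc m) (suc n) = <ᵇ-trichotomy m n

-- For complementary events x and y, the event b occurs either together with x, which x alone
-- bounds, or together with y.
𝟙-split : ∀ b {x y} → x + y ≡ 1 → 𝟙 b ≤ x + 𝟙 b * y
𝟙-split true  {x} {y} x+y≡1 = ℕₚ.≤-reflexive (sym (trans (cong (_+_ x) (ℕₚ.+-identityʳ y)) x+y≡1))
𝟙-split false x+y≡1 = z≤n

-- Sums over lists and tuples

lsum-swap : ∀ {X Y : Set} (f : X → Y → ℕ) xs ys →
            lsum (λ x → lsum (f x) ys) xs ≡ lsum (λ y → lsum (λ x → f x y) xs) ys
lsum-swap f []       ys = sym (lsum-0 ys)
lsum-swap f (x ∷ xs) ys =
  trans (cong (_+_ (lsum (f x) ys)) (lsum-swap f xs ys)) (sym (lsum-+ (f x) _ ys))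

lsum-product : ∀ {X Y : Set} (f : X → ℕ) (g : Y → ℕ) xs ys →
               lsum f xs * lsum g ys ≡ lsum (λ x → lsum (λ y → f x * g y) ys) xs
lsum-product f g []       ys = refl
lsum-product f g (x ∷ xs) ys =
  trans (ℕₚ.*-distribʳ-+ (lsum g ys) (f x) (lsum f xs))
        (cong₂ _+_ (sym (lsum-* (f x) g ys)) (lsum-product f g xs ys))

tupΣ-mono : ∀ {X : Set} (us : List X) k {g h} → (∀ xs → g xs ≤ h xs) → tupΣ us k g ≤ tupΣ us k h
tupΣ-mono us zero    g≤h = g≤h []
tupΣ-mono us (suc k) g≤h = lsum-mono (λ u → tupΣ-mono us k (λ xs → g≤h (u ∷ xs))) us

tupΣ-+ : ∀ {X : Set} (us : List X) k g h →
         tupΣ us k (λ xs → g xs + h xs) ≡ tupΣ us k g + tupΣ us k h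
tupΣ-+ us zero    g h = refl
tupΣ-+ us (suc k) g h =
  trans (lsum-cong (λ u → tupΣ-+ us k (g ∘ (u ∷_)) (h ∘ (u ∷_))) us) (lsum-+ _ _ us)

tupΣ-* : ∀ {X : Set} (us : List X) k c g → tupΣ us k (λ xs → c * g xs) ≡ c * tupΣ us k g
tupΣ-* us zero    c g = refl
tupΣ-* us (suc k) c g = trans (lsum-cong (λ u → tupΣ-* us k c (g ∘ (u ∷_))) us) (lsum-* c _ us)

tupΣ-1 : ∀ {X : Set} (us : List X) k → tupΣ us k (λ _ → 1) ≡ length us ^ k
tupΣ-1 us zero    = refl
tupΣ-1 us (suc k) = trans (lsum-cong (λ _ → tupΣ-1 us k) us) (lsum-const _ us)

tupΣ-lsum : ∀ {X Y : Set} (us : List X) k (h : Y → List X → ℕ) ys →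
            tupΣ us k (λ xs → lsum (λ y → h y xs) ys) ≡ lsum (λ y → tupΣ us k (h y)) ys
tupΣ-lsum us zero    h ys = refl
tupΣ-lsum us (suc k) h ys =
  trans (lsum-cong (λ u → tupΣ-lsum us k (λ y → h y ∘ (u ∷_)) ys) us)
        (lsum-swap (λ u y → tupΣ us k (h y ∘ (u ∷_))) us ys)

-- Induction on the length k and, inside it, on the list of possible first entries; each step is the
-- two-term inequality.
tupΣ-cauchy-schwarz : ∀ {X : Set} (us : List X) k g a b → (∀ xs → g xs * g xs ≤ a xs * b xs) →
                      tupΣ us k g * tupΣ us k g ≤ tupΣ us k a * tupΣ us k b
tupΣ-cauchy-schwarz us zero    g a b g²≤ab = g²≤ab []
tupΣ-cauchy-schwarz {X} us (suc k) g a b g²≤ab = go us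
  where
  -- The first entry ranges over vs and the others over all of `us`, so that the recursion can
  -- shorten vs alone.
  Σ[_] : (List X → ℕ) → List X → ℕ
  Σ[ h ] vs = lsum (λ u → tupΣ us k (h ∘ (u ∷_))) vs
  go : ∀ vs → Σ[ g ] vs * Σ[ g ] vs ≤ Σ[ a ] vs * Σ[ b ] vs
  go []       = z≤n
  go (v ∷ vs) = cauchy-schwarz₂ (tupΣ us k (g ∘ (v ∷_))) (Σ[ g ] vs)
    (tupΣ us k (a ∘ (v ∷_))) _ (Σ[ a ] vs) _
    (tupΣ-cauchy-schwarz us k (g ∘ (v ∷_)) _ _ (λ xs → g²≤ab (v ∷ xs))) (go vs)

-- Sum of h x ys over the ways of removing one entry x from a list, leaving ys.
pickΣ : ∀ {X : Set} → (X → List X → ℕ) → List X → ℕ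
pickΣ h []       = 0
pickΣ h (x ∷ xs) = h x xs + pickΣ (λ y ys → h y (x ∷ ys)) xs

-- The permutation is handed to the hypothesis so that symmetric quantities of `y ∷ ys`, such as its
-- number of edges, can be read off from `xs`.
pickΣ-mono : ∀ {X : Set} xs {g h : X → List X → ℕ} →
             (∀ y ys → y ∷ ys ↭ xs → g y ys ≤ h y ys) → pickΣ g xs ≤ pickΣ h xs
pickΣ-mono []       g≤h = z≤n
pickΣ-mono (x ∷ xs) g≤h = ℕₚ.+-mono-≤ (g≤h x xs Perm.refl) (pickΣ-mono xs
  (λ y ys p → g≤h y (x ∷ ys) (Perm.trans (swap y x Perm.refl) (prep x p))))

pickΣ-+ : ∀ {X : Set} (g h : X → List X → ℕ) xs →
          pickΣ (λ y ys → g y ys + h y ys) xs ≡ pickΣ g xs + pickΣ h xs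
pickΣ-+ g h []       = refl
pickΣ-+ g h (x ∷ xs) = trans (cong (_+_ (g x xs + h x xs)) (pickΣ-+ _ _ xs))
                             (shuffle (g x xs) (h x xs) _ _)
  where
  shuffle : ∀ a b c d → (a + b) + (c + d) ≡ (a + c) + (b + d)
  shuffle = solve-∀

pickΣ-* : ∀ {X : Set} c (h : X → List X → ℕ) xs →
          pickΣ (λ y ys → c * h y ys) xs ≡ c * pickΣ h xs
pickΣ-* c h []       = sym (ℕₚ.*-zeroʳ c)
pickΣ-* c h (x ∷ xs) = trans (cong (_+_ (c * h x xs)) (pickΣ-* c _ xs))
                             (sym (ℕₚ.*-distribˡ-+ c (h x xs) _))

pickΣ-lsum : ∀ {X : Set} (f : X → ℕ) xs → pickΣ (λ y _ → f y) xs ≡ lsum f xs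
pickΣ-lsum f []       = refl
pickΣ-lsum f (x ∷ xs) = cong (_+_ (f x)) (pickΣ-lsum f xs)

-- Exchangeability: the removed entry may stand in any of `suc k` positions, and each position
-- contributes the same sum because removal keeps the order of the other entries.
tupΣ-pickΣ : ∀ {X : Set} (us : List X) k (h : X → List X → ℕ) →
  tupΣ us (suc k) (pickΣ h) ≡ suc k * lsum (λ x → tupΣ us k (h x)) us
tupΣ-pickΣ us zero    h =
  trans (lsum-cong (λ x → ℕₚ.+-identityʳ (h x [])) us) (sym (ℕₚ.+-identityʳ _))
tupΣ-pickΣ us (suc k) h = begin-equality
  lsum (λ x → tupΣ us (suc k) (λ xs → h x xs + pickΣ (h′ x) xs)) us
    ≡⟨ lsum-cong (λ x → tupΣ-+ us (suc k) (h x) (pickΣ (h′ x))) us ⟩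
  lsum (λ x → tupΣ us (suc k) (h x) + tupΣ us (suc k) (pickΣ (h′ x))) us
    ≡⟨ lsum-+ _ _ us ⟩
  S + lsum (λ x → tupΣ us (suc k) (pickΣ (h′ x))) us
    ≡⟨ cong (_+_ S) (lsum-cong (λ x → tupΣ-pickΣ us k (h′ x)) us) ⟩
  S + lsum (λ x → suc k * lsum (λ y → tupΣ us k (h′ x y)) us) us
    ≡⟨ cong (_+_ S) (lsum-* (suc k) _ us) ⟩
  S + suc k * lsum (λ x → lsum (λ y → tupΣ us k (h′ x y)) us) us
    ≡⟨ cong (λ z → S + suc k * z) (lsum-swap (λ x y → tupΣ us k (h′ x y)) us us) ⟩
  suc (suc k) * S ∎
  where
  h′ = λ x y ys → h y (x ∷ ys)
  S = lsum (λ x → tupΣ us (suc k) (h x)) us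

tupΣ-pickΣ² : ∀ {X : Set} (us : List X) k (h : X → X → List X → ℕ) →
  tupΣ us (suc (suc k)) (pickΣ (λ x → pickΣ (h x)))
    ≡ suc (suc k) * (suc k * lsum (λ x → lsum (λ y → tupΣ us k (h x y)) us) us)
tupΣ-pickΣ² us k h = trans (tupΣ-pickΣ us (suc k) (λ x → pickΣ (h x)))
  (cong (suc (suc k) *_)
    (trans (lsum-cong (λ x → tupΣ-pickΣ us k (h x)) us) (lsum-* (suc k) _ us)))

pickΣ-≤0 : ∀ {X : Set} xs {h : X → List X → ℕ} →
           (∀ y ys → y ∷ ys ↭ xs → h y ys ≤ 0) → pickΣ h xs ≤ 0
pickΣ-≤0 xs h≤0 = ℕₚ.≤-trans (pickΣ-mono xs h≤0)
  (ℕₚ.≤-reflexive (trans (pickΣ-lsum (λ _ → 0) xs) (lsum-0 xs)))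

-- Edge counts of vertices sampled with replacement.

module Sampling {X : Set} (us : List X) (E : X → X → Bool) (E-sym : ∀ x y → E x y ≡ E y x) where

  edges : List X → ℕ
  edges = edgesL E

  deg : X → List X → ℕ
  deg x = lsum (𝟙 ∘ E x)

  N : ℕ
  N = length us

  edges-↭ : ∀ {xs ys} → xs ↭ ys → edges xs ≡ edges ys
  edges-↭ = edgesL-↭ E E-sym

  handshake : ∀ xs → pickΣ deg xs ≡ 2 * edges xs
  handshake []       = refl
  handshake (x ∷ xs) = begin-equality
    deg x xs + pickΣ (λ y ys → 𝟙 (E y x) + deg y ys) xs
      ≡⟨ cong (_+_ (deg x xs)) (pickΣ-+ (λ y _ → 𝟙 (E y x)) deg xs) ⟩
    deg x xs + (pickΣ (λ y _ → 𝟙 (E y x)) xs + pickΣ deg xs)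
      ≡⟨ cong₂ (λ a b → deg x xs + (a + b))
           (trans (pickΣ-lsum _ xs) (lsum-cong (λ y → cong 𝟙 (E-sym y x)) xs)) (handshake xs) ⟩
    deg x xs + (deg x xs + 2 * edges xs)
      ≡⟨ double (deg x xs) (edges xs) ⟩
    2 * edges (x ∷ xs) ∎
    where
    double : ∀ a b → a + (a + 2 * b) ≡ 2 * (a + b)
    double = solve-∀

  -- The test `s <ᵇ suc e` encodes s ≤ e. The indicator marks x as critical for the threshold s: its
  -- removal takes the edge count below s.
  prefix<≤ : ℕ → X → List X → ℕ
  prefix<≤ s x xs = 𝟙 (edges xs <ᵇ s) * 𝟙 (s <ᵇ suc (edges (x ∷ xs)))

  -- In a list with M edges a critical vertex of degree d satisfies M ≤ sd, while all degrees add up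
  -- to 2M. Hence at most 2s vertices are critical.
  pickΣ-prefix<≤ : ∀ s xs → 0 < s → pickΣ (prefix<≤ s) xs ≤ 2 * s
  pickΣ-prefix<≤ s xs 0<s with edges xs in eq
  -- Without edges no positive threshold is reached; this case is kept apart because the other one
  -- cancels `M`.
  ... | zero  = ℕₚ.≤-trans (pickΣ-≤0 xs vanish) z≤n
    where
    vanish : ∀ y ys → y ∷ ys ↭ xs → prefix<≤ s y ys ≤ 0
    vanish y ys p = 𝟙*-≤ (edges ys <ᵇ s) λ _ →
      ℕₚ.≤-trans (ℕₚ.≤-reflexive (sym (ℕₚ.*-identityʳ _)))
        (𝟙*-≤ (s <ᵇ suc (edges (y ∷ ys))) {1} λ t → ⊥-elim
          (ℕₚ.<⇒≱ 0<s (subst (s ≤_) (trans (edges-↭ p) eq) (ℕₚ.≤-pred (ℕₚ.<ᵇ⇒< s _ t)))))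
  ... | M@(suc _) = ℕₚ.*-cancelˡ-≤ M (begin
    M * pickΣ (prefix<≤ s) xs               ≡⟨ sym (pickΣ-* M _ xs) ⟩
    pickΣ (λ y ys → M * prefix<≤ s y ys) xs ≤⟨ pickΣ-mono xs term ⟩
    pickΣ (λ y ys → s * deg y ys) xs        ≡⟨ pickΣ-* s deg xs ⟩
    s * pickΣ deg xs                        ≡⟨ cong (s *_) (trans (handshake xs) (cong (2 *_) eq)) ⟩
    s * (2 * M)                             ≡⟨ rearrange s M ⟩
    M * (2 * s)                             ∎)
    where
    rearrange : ∀ s M → s * (2 * M) ≡ M * (2 * s)
    rearrange = solve-∀
    rearrange′ : ∀ a b c → a * (b * c) ≡ b * (c * a)
    rearrange′ = solve-∀
    -- A critical vertex has d ≥ 1, and e ≤ s - 1 ≤ (s - 1)d.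
    bound : ∀ d e → e < s → s ≤ d + e → d + e ≤ s * d
    bound zero      e e<s s≤e = ⊥-elim (ℕₚ.<⇒≱ e<s s≤e)
    bound d@(suc d′) e e<s _  = begin
      d + e              ≤⟨ ℕₚ.+-monoʳ-≤ d (ℕₚ.≤-pred (ℕₚ.≤-trans e<s (ℕₚ.≤-reflexive (sym (ℕₚ.suc-pred s {{>-nonZero 0<s}}))))) ⟩
      d + ℕ.pred s       ≤⟨ ℕₚ.+-monoʳ-≤ d (ℕₚ.m≤m*n (ℕ.pred s) d) ⟩
      suc (ℕ.pred s) * d ≡⟨ cong (_* d) (ℕₚ.suc-pred s {{>-nonZero 0<s}}) ⟩
      s * d              ∎
    term : ∀ y ys → y ∷ ys ↭ xs → M * prefix<≤ s y ys ≤ s * deg y ys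
    term y ys p = begin
      M * (𝟙 (edges ys <ᵇ s) * 𝟙 (s <ᵇ suc (edges (y ∷ ys))))
        ≡⟨ rearrange′ M (𝟙 (edges ys <ᵇ s)) (𝟙 (s <ᵇ suc (edges (y ∷ ys)))) ⟩
      𝟙 (edges ys <ᵇ s) * (𝟙 (s <ᵇ suc (edges (y ∷ ys))) * M)
        ≤⟨ 𝟙*-≤ (edges ys <ᵇ s) (λ t → 𝟙*-≤ (s <ᵇ suc (edges (y ∷ ys))) (λ t′ →
             subst (_≤ s * deg y ys) (trans (edges-↭ p) eq)
               (bound (deg y ys) (edges ys) (ℕₚ.<ᵇ⇒< _ _ t) (ℕₚ.≤-pred (ℕₚ.<ᵇ⇒< s _ t′))))) ⟩
      s * deg y ys ∎

  -- By exchangeability the last vertex drawn is one of the at most 2s critical ones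
  -- with probability at most 2s/(k+1).
  crossing : ∀ k s → 0 < s →
    suc k * lsum (λ x → tupΣ us k (prefix<≤ s x)) us ≤ 2 * s * N ^ suc k
  crossing k s 0<s = begin
    suc k * lsum (λ x → tupΣ us k (prefix<≤ s x)) us
      ≡⟨ sym (tupΣ-pickΣ us k (prefix<≤ s)) ⟩
    tupΣ us (suc k) (pickΣ (prefix<≤ s))
      ≤⟨ tupΣ-mono us (suc k) (λ xs → ℕₚ.≤-trans (pickΣ-prefix<≤ s xs 0<s)
           (ℕₚ.≤-reflexive (sym (ℕₚ.*-identityʳ (2 * s))))) ⟩
    tupΣ us (suc k) (λ _ → 2 * s * 1)
      ≡⟨ trans (tupΣ-* us (suc k) (2 * s) (λ _ → 1)) (cong (2 * s *_) (tupΣ-1 us (suc k))) ⟩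
    2 * s * N ^ suc k ∎

  -- First and second moments of the jumps to exactly ℓ edges.

  module _ (ℓ : ℕ) where

    below hit above : List X → ℕ
    below xs = 𝟙 (edges xs <ᵇ ℓ)
    hit   xs = 𝟙 (edges xs ≡ᵇ ℓ)
    above xs = 𝟙 (ℓ <ᵇ edges xs)

    -- deg x xs if adding x to xs brings the number of edges to exactly ℓ, and 0 otherwise
    jump : X → List X → ℕ
    jump x xs = 𝟙 (edges (x ∷ xs) ≡ᵇ ℓ) * (ℓ ∸ edges xs)

    -- This is φ scaled by `N`, the number of choices for the next vertex.
    jumps : List X → ℕ
    jumps xs = lsum (λ x → jump x xs) us

    -- If `xs` spans exactly ℓ edges, putting a removed entry back is a jump worth its degree, and
    -- the degrees add up to 2ℓ.
    hit≤pickΣ-jump : ∀ xs → 2 * ℓ * hit xs ≤ pickΣ jump xs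
    hit≤pickΣ-jump xs = ℕₚ.≤-trans (ℕₚ.≤-reflexive (ℕₚ.*-comm (2 * ℓ) (hit xs)))
      (𝟙*-≤ (edges xs ≡ᵇ ℓ) λ t → begin
        2 * ℓ          ≡⟨ cong (2 *_) (sym (ℕₚ.≡ᵇ⇒≡ (edges xs) ℓ t)) ⟩
        2 * edges xs   ≡⟨ sym (handshake xs) ⟩
        pickΣ deg xs   ≤⟨ pickΣ-mono xs (deg≤jump t) ⟩
        pickΣ jump xs  ∎)
      where
      deg≤jump : T (edges xs ≡ᵇ ℓ) → ∀ y ys → y ∷ ys ↭ xs → deg y ys ≤ jump y ys
      deg≤jump t y ys p = begin
        deg y ys        ≡⟨ sym (ℕₚ.m+n∸n≡m (deg y ys) (edges ys)) ⟩
        edges (y ∷ ys) ∸ edges ys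
                        ≡⟨ cong (_∸ edges ys) e≡ℓ ⟩
        ℓ ∸ edges ys    ≤⟨ ≤-𝟙* (edges (y ∷ ys) ≡ᵇ ℓ) (ℕₚ.≡⇒≡ᵇ _ _ e≡ℓ) ⟩
        jump y ys       ∎
        where
        e≡ℓ : edges (y ∷ ys) ≡ ℓ
        e≡ℓ = trans (edges-↭ p) (ℕₚ.≡ᵇ⇒≡ _ _ t)

    first-moment : ∀ k → 2 * ℓ * tupΣ us (suc k) hit ≤ suc k * tupΣ us k jumps
    first-moment k = begin
      2 * ℓ * tupΣ us (suc k) hit                   ≡⟨ sym (tupΣ-* us (suc k) (2 * ℓ) hit) ⟩
      tupΣ us (suc k) (λ xs → 2 * ℓ * hit xs)       ≤⟨ tupΣ-mono us (suc k) hit≤pickΣ-jump ⟩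
      tupΣ us (suc k) (pickΣ jump)                  ≡⟨ tupΣ-pickΣ us k jump ⟩
      suc k * lsum (λ x → tupΣ us k (jump x)) us    ≡⟨ cong (suc k *_) (sym (tupΣ-lsum us k jump us)) ⟩
      suc k * tupΣ us k jumps                       ∎

    -- A jump has positive weight only if edges are missing, so φ vanishes outside the event
    -- `below`. This is the pointwise hypothesis for Cauchy-Schwarz.
    jumps²≤below*jumps² : ∀ xs → jumps xs * jumps xs ≤ below xs * (jumps xs * jumps xs)
    jumps²≤below*jumps² xs with edges xs <ᵇ ℓ in eq
    ... | true  = ℕₚ.m≤m+n _ 0
    ... | false = ℕₚ.≤-reflexive (cong (λ z → z * z) (trans (lsum-cong no-jump us) (lsum-0 us)))
      where
      ℓ≤e : ℓ ≤ edges xs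
      ℓ≤e = ℕₚ.≮⇒≥ λ e<ℓ → subst T eq (ℕₚ.<⇒<ᵇ e<ℓ)
      no-jump : ∀ x → jump x xs ≡ 0
      no-jump x = trans (cong (𝟙 (edges (x ∷ xs) ≡ᵇ ℓ) *_) (ℕₚ.m≤n⇒m∸n≡0 ℓ≤e)) (ℕₚ.*-zeroʳ (𝟙 (edges (x ∷ xs) ≡ᵇ ℓ)))

    jump² : X → X → List X → ℕ
    jump² x y xs = jump x xs * jump y xs

    -- If x and y each supply the d missing edges, the whole list has at least ℓ + d edges; having
    -- at most ℓ forces d = 0.
    jump²-sparse : ∀ x y xs → edges (x ∷ y ∷ xs) ≤ ℓ → jump² x y xs ≤ 0
    jump²-sparse x y xs e≤ℓ = 𝟙*-≤² (edges (x ∷ xs) ≡ᵇ ℓ) (edges (y ∷ xs) ≡ᵇ ℓ) λ t u →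
      ℕₚ.≤-reflexive (cong (_* (ℓ ∸ edges xs)) (d≡0 t u))
      where
      d≡0 : T (edges (x ∷ xs) ≡ᵇ ℓ) → T (edges (y ∷ xs) ≡ᵇ ℓ) → ℓ ∸ edges xs ≡ 0
      d≡0 t u = ℕₚ.m≤n⇒m∸n≡0 (ℕₚ.≤-trans (ℕₚ.≤-reflexive (sym (ℕₚ.≡ᵇ⇒≡ _ _ u)))
        (ℕₚ.+-cancelˡ-≤ (deg x xs) _ _ (begin
          deg x xs + edges (y ∷ xs)       ≤⟨ ℕₚ.+-monoˡ-≤ _ (ℕₚ.m≤n+m (deg x xs) (𝟙 (E x y))) ⟩
          edges (x ∷ y ∷ xs)              ≤⟨ e≤ℓ ⟩
          ℓ                               ≡⟨ sym (ℕₚ.≡ᵇ⇒≡ _ _ t) ⟩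
          deg x xs + edges xs             ∎)))

    -- If d edges are missing and x and y each supply them, the whole list has
    -- ℓ + d + a edges, where a is 1 or 0 according to whether x and y are
    -- adjacent, and (ℓ + d + a) d ≤ 2ℓ (d + a) because d ≤ ℓ.
    jump²-bound : ∀ x y xs → let M = edges (x ∷ y ∷ xs) in
      M * M * jump² x y xs ≤ (2 * ℓ * deg x (y ∷ xs)) * (2 * ℓ * deg y (x ∷ xs))
    jump²-bound x y xs = begin
      M * M * jump² x y xs
        ≡⟨ rearrange M (𝟙 (edges (x ∷ xs) ≡ᵇ ℓ)) d (𝟙 (edges (y ∷ xs) ≡ᵇ ℓ)) ⟩
      (𝟙 (edges (x ∷ xs) ≡ᵇ ℓ) * (M * d)) * (𝟙 (edges (y ∷ xs) ≡ᵇ ℓ) * (M * d))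
        ≤⟨ 𝟙*-≤² (edges (x ∷ xs) ≡ᵇ ℓ) (edges (y ∷ xs) ≡ᵇ ℓ) (λ t u →
             let deg-x = missing x t ; deg-y = missing y u in
             ℕₚ.*-mono-≤
               (subst₂ (λ p q → (𝟙 (E x y) + p + (q + edges xs)) * d ≤ 2 * ℓ * (𝟙 (E x y) + p))
                 (sym deg-x) (sym deg-y) (bound (𝟙 (E x y)) t))
               (subst₂ (λ p q → (𝟙 (E x y) + p + (q + edges xs)) * d ≤ 2 * ℓ * (𝟙 (E y x) + q))
                 (sym deg-x) (sym deg-y)
                 (subst (λ b → (𝟙 (E x y) + d + (d + edges xs)) * d ≤ 2 * ℓ * (𝟙 b + d))
                   (E-sym x y) (bound (𝟙 (E x y)) t)))) ⟩
      (2 * ℓ * deg x (y ∷ xs)) * (2 * ℓ * deg y (x ∷ xs)) ∎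
      where
      M = edges (x ∷ y ∷ xs)
      d = ℓ ∸ edges xs
      rearrange : ∀ m a d b → m * m * ((a * d) * (b * d)) ≡ (a * (m * d)) * (b * (m * d))
      rearrange = solve-∀
      missing : ∀ z → T (edges (z ∷ xs) ≡ᵇ ℓ) → deg z xs ≡ d
      missing z t = trans (sym (ℕₚ.m+n∸n≡m (deg z xs) (edges xs)))
                          (cong (_∸ edges xs) (ℕₚ.≡ᵇ⇒≡ (edges (z ∷ xs)) ℓ t))
      bound : ∀ a → T (edges (x ∷ xs) ≡ᵇ ℓ) → (a + d + (d + edges xs)) * d ≤ 2 * ℓ * (a + d)
      bound a t = begin
        (a + d + (d + edges xs)) * d
          ≡⟨ cong (λ z → (a + d + z) * d) (trans (cong (_+ edges xs) (sym (missing x t))) (ℕₚ.≡ᵇ⇒≡ _ _ t)) ⟩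
        (a + d + ℓ) * d          ≡⟨ ℕₚ.*-distribʳ-+ d (a + d) ℓ ⟩
        (a + d) * d + ℓ * d      ≤⟨ ℕₚ.+-mono-≤ (ℕₚ.*-monoʳ-≤ (a + d) (ℕₚ.m∸n≤m ℓ (edges xs)))
                                                (ℕₚ.*-monoʳ-≤ ℓ (ℕₚ.m≤n+m d a)) ⟩
        (a + d) * ℓ + ℓ * (a + d) ≡⟨ double (a + d) ℓ ⟩
        2 * ℓ * (a + d)          ∎
        where
        double : ∀ z l → z * l + l * z ≡ 2 * l * z
        double = solve-∀

    -- After multiplication by M², each ordered pair contributes at most 4ℓ² times the product of
    -- its degrees. Two handshake sums bound the total of these products by (2M)², whence 16ℓ².
    pickΣ-jump²-dense : ∀ xs → ℓ < edges xs →
                        pickΣ (λ x → pickΣ (jump² x)) xs ≤ 16 * (ℓ * ℓ)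
    pickΣ-jump²-dense xs ℓ<M =
      ℕₚ.*-cancelˡ-≤ (M * M) {{ℕₚ.m*n≢0 M M {{M≢0}} {{M≢0}}}} (begin
        M * M * pickΣ (λ x → pickΣ (jump² x)) xs
          ≡⟨ sym (pickΣ-* (M * M) (λ x → pickΣ (jump² x)) xs) ⟩
        pickΣ (λ x ys → M * M * pickΣ (jump² x) ys) xs
          ≤⟨ pickΣ-mono xs outer ⟩
        pickΣ (λ x ys → 2 * ℓ * (2 * M) * (2 * ℓ) * deg x ys) xs
          ≡⟨ trans (pickΣ-* (2 * ℓ * (2 * M) * (2 * ℓ)) deg xs) (cong (2 * ℓ * (2 * M) * (2 * ℓ) *_) (handshake xs)) ⟩
        2 * ℓ * (2 * M) * (2 * ℓ) * (2 * M)
          ≡⟨ collect ℓ M ⟩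
        M * M * (16 * (ℓ * ℓ)) ∎)
      where
      M = edges xs
      M≢0 : NonZero M
      M≢0 = >-nonZero (ℕₚ.≤-<-trans z≤n ℓ<M)
      collect : ∀ l m → 2 * l * (2 * m) * (2 * l) * (2 * m) ≡ m * m * (16 * (l * l))
      collect = solve-∀
      regroup : ∀ l d z → (2 * l * d) * (2 * l * z) ≡ 2 * l * d * (2 * l) * z
      regroup = solve-∀
      regroup′ : ∀ l d m → 2 * l * d * (2 * l) * (2 * m) ≡ 2 * l * (2 * m) * (2 * l) * d
      regroup′ = solve-∀
      outer : ∀ x ys → x ∷ ys ↭ xs →
              M * M * pickΣ (jump² x) ys ≤ 2 * ℓ * (2 * M) * (2 * ℓ) * deg x ys
      outer x ys p = begin
        M * M * pickΣ (jump² x) ys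
          ≡⟨ sym (pickΣ-* (M * M) (jump² x) ys) ⟩
        pickΣ (λ y zs → M * M * jump² x y zs) ys
          ≤⟨ pickΣ-mono ys inner ⟩
        pickΣ (λ y zs → c * deg y (x ∷ zs)) ys
          ≡⟨ pickΣ-* c (λ y zs → deg y (x ∷ zs)) ys ⟩
        c * pickΣ (λ y zs → deg y (x ∷ zs)) ys
          -- Adding the degree of x completes the handshake sum of the whole list.
          ≤⟨ ℕₚ.*-monoʳ-≤ c (ℕₚ.m≤n+m _ (deg x ys)) ⟩
        c * pickΣ deg (x ∷ ys)
          ≡⟨ cong (c *_) (trans (handshake (x ∷ ys)) (cong (2 *_) (edges-↭ p))) ⟩
        c * (2 * M)
          ≡⟨ regroup′ ℓ (deg x ys) M ⟩
        2 * ℓ * (2 * M) * (2 * ℓ) * deg x ys ∎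
        where
        c = 2 * ℓ * deg x ys * (2 * ℓ)
        inner : ∀ y zs → y ∷ zs ↭ ys → M * M * jump² x y zs ≤ c * deg y (x ∷ zs)
        inner y zs r = begin
          M * M * jump² x y zs
            ≡⟨ cong (λ m → m * m * jump² x y zs) (sym (edges-↭ (Perm.trans (prep x r) p))) ⟩
          edges (x ∷ y ∷ zs) * edges (x ∷ y ∷ zs) * jump² x y zs
            ≤⟨ jump²-bound x y zs ⟩
          (2 * ℓ * deg x (y ∷ zs)) * (2 * ℓ * deg y (x ∷ zs))
            ≡⟨ cong (λ z → (2 * ℓ * z) * (2 * ℓ * deg y (x ∷ zs))) (lsum-↭ (𝟙 ∘ E x) r) ⟩
          (2 * ℓ * deg x ys) * (2 * ℓ * deg y (x ∷ zs))
            ≡⟨ regroup ℓ (deg x ys) (deg y (x ∷ zs)) ⟩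
          c * deg y (x ∷ zs) ∎

    pickΣ-jump²≤above : ∀ xs → pickΣ (λ x → pickΣ (jump² x)) xs ≤ 16 * (ℓ * ℓ) * above xs
    pickΣ-jump²≤above xs with ℓ <ᵇ edges xs in eq
    ... | true  = ℕₚ.≤-trans (pickΣ-jump²-dense xs (ℕₚ.<ᵇ⇒< ℓ _ (subst T (sym eq) tt)))
                             (ℕₚ.≤-reflexive (sym (ℕₚ.*-identityʳ _)))
    ... | false = ℕₚ.≤-trans (pickΣ-≤0 xs λ x ys p → pickΣ-≤0 ys λ y zs r →
        jump²-sparse x y zs (subst (_≤ ℓ) (sym (edges-↭ (Perm.trans (prep x r) p))) e≤ℓ)) z≤n
      where
      e≤ℓ : edges xs ≤ ℓ
      e≤ℓ = ℕₚ.≮⇒≥ λ ℓ<e → subst T eq (ℕₚ.<⇒<ᵇ ℓ<e)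

    -- The square of φ expands into ordered pairs of further vertices, which exchangeability turns
    -- into pairs removed from a sample of k + 2 vertices.
    second-moment : ∀ k → suc (suc k) * (suc k * tupΣ us k (λ xs → jumps xs * jumps xs))
                            ≤ 16 * (ℓ * ℓ) * tupΣ us (suc (suc k)) above
    second-moment k = begin
      suc (suc k) * (suc k * tupΣ us k (λ xs → jumps xs * jumps xs))
        ≡⟨ cong (λ z → suc (suc k) * (suc k * z)) expand ⟩
      suc (suc k) * (suc k * lsum (λ x → lsum (λ y → tupΣ us k (jump² x y)) us) us)
        ≡⟨ sym (tupΣ-pickΣ² us k jump²) ⟩
      tupΣ us (suc (suc k)) (pickΣ (λ x → pickΣ (jump² x)))
        ≤⟨ tupΣ-mono us (suc (suc k)) pickΣ-jump²≤above ⟩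
      tupΣ us (suc (suc k)) (λ xs → 16 * (ℓ * ℓ) * above xs)
        ≡⟨ tupΣ-* us (suc (suc k)) (16 * (ℓ * ℓ)) above ⟩
      16 * (ℓ * ℓ) * tupΣ us (suc (suc k)) above ∎
      where
      expand : tupΣ us k (λ xs → jumps xs * jumps xs)
             ≡ lsum (λ x → lsum (λ y → tupΣ us k (jump² x y)) us) us
      expand = trans (tupΣ-cong us k (λ xs → lsum-product (λ x → jump x xs) (λ y → jump y xs) us us))
        (trans (tupΣ-lsum us k (λ x xs → lsum (λ y → jump² x y xs) us) us)
               (lsum-cong (λ x → tupΣ-lsum us k (jump² x) us) us))

    -- Cauchy-Schwarz links the two moments. The sample sizes k and k + 2 lie symmetrically about k
    -- + 1, so both sides carry the same power of `N`.
    hit²≤4*below*above : 0 < ℓ → ∀ k →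
      tupΣ us (suc k) hit * tupΣ us (suc k) hit ≤ 4 * (tupΣ us k below * tupΣ us (suc (suc k)) above)
    hit²≤4*below*above 0<ℓ k =
      ℕₚ.*-cancelˡ-≤ (4 * (ℓ * ℓ) * suc (suc k)) {{nonZero}} (begin
        4 * (ℓ * ℓ) * suc (suc k) * (P * P)
          ≡⟨ regroup₁ ℓ (suc (suc k)) P ⟩
        suc (suc k) * ((2 * ℓ * P) * (2 * ℓ * P))
          ≤⟨ ℕₚ.*-monoʳ-≤ (suc (suc k)) (ℕₚ.*-mono-≤ (first-moment k) (first-moment k)) ⟩
        suc (suc k) * ((suc k * F) * (suc k * F))
          ≡⟨ regroup₂ (suc (suc k)) (suc k) F ⟩
        suc (suc k) * (suc k * suc k) * (F * F)
          ≤⟨ ℕₚ.*-monoʳ-≤ (suc (suc k) * (suc k * suc k))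
               (tupΣ-cauchy-schwarz us k jumps below (λ xs → jumps xs * jumps xs) jumps²≤below*jumps²) ⟩
        suc (suc k) * (suc k * suc k) * (Q * Φ)
          ≡⟨ regroup₃ (suc (suc k)) (suc k) Q Φ ⟩
        suc k * Q * (suc (suc k) * (suc k * Φ))
          ≤⟨ ℕₚ.*-monoʳ-≤ (suc k * Q) (second-moment k) ⟩
        -- Raising k + 1 to k + 2 costs a factor close to 1 and allows k + 2 to be cancelled.
        suc k * Q * (16 * (ℓ * ℓ) * R)
          ≤⟨ ℕₚ.*-monoˡ-≤ (16 * (ℓ * ℓ) * R) (ℕₚ.*-monoˡ-≤ Q (ℕₚ.n≤1+n (suc k))) ⟩
        suc (suc k) * Q * (16 * (ℓ * ℓ) * R)
          ≡⟨ regroup₄ (suc (suc k)) Q ℓ R ⟩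
        4 * (ℓ * ℓ) * suc (suc k) * (4 * (Q * R)) ∎)
      where
      P = tupΣ us (suc k) hit
      Q = tupΣ us k below
      R = tupΣ us (suc (suc k)) above
      F = tupΣ us k jumps
      Φ = tupΣ us k (λ xs → jumps xs * jumps xs)
      nonZero : NonZero (4 * (ℓ * ℓ) * suc (suc k))
      nonZero = >-nonZero (ℕₚ.*-mono-< {0} {4 * (ℓ * ℓ)} {0}
        (ℕₚ.*-mono-< {0} {4} {0} z<s (ℕₚ.*-mono-< {0} {ℓ} {0} 0<ℓ 0<ℓ)) z<s)
      regroup₁ : ∀ l k p → 4 * (l * l) * k * (p * p) ≡ k * ((2 * l * p) * (2 * l * p))
      regroup₁ = solve-∀
      regroup₂ : ∀ k j f → k * ((j * f) * (j * f)) ≡ k * (j * j) * (f * f)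
      regroup₂ = solve-∀
      regroup₃ : ∀ k j q r → k * (j * j) * (q * r) ≡ j * q * (k * (j * r))
      regroup₃ = solve-∀
      regroup₄ : ∀ k q l r → k * q * (16 * (l * l) * r) ≡ 4 * (l * l) * k * (4 * (q * r))
      regroup₄ = solve-∀

    -- Comparing consecutive sample sizes, and the bound for tuples.

    -- A sample with fewer than ℓ edges either stays below ℓ when a vertex is added or crosses ℓ,
    -- and crossings are rare.
    below-step : 0 < ℓ → ∀ k →
      suc k * (N * tupΣ us k below) ≤ suc k * tupΣ us (suc k) below + 2 * ℓ * N ^ suc k
    below-step 0<ℓ k = begin
      suc k * (N * tupΣ us k below)
        ≡⟨ cong (suc k *_) (sym (lsum-const (tupΣ us k below) us)) ⟩
      suc k * lsum (λ _ → tupΣ us k below) us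
        ≤⟨ ℕₚ.*-monoʳ-≤ (suc k) (lsum-mono (λ x → tupΣ-mono us k (λ xs →
             𝟙-split (edges xs <ᵇ ℓ) (<ᵇ-dichotomy (edges (x ∷ xs)) ℓ))) us) ⟩
      suc k * lsum (λ x → tupΣ us k (λ xs → below (x ∷ xs) + prefix<≤ ℓ x xs)) us
        ≡⟨ cong (suc k *_) (trans (lsum-cong (λ x → tupΣ-+ us k (below ∘ (x ∷_)) (prefix<≤ ℓ x)) us)
             (lsum-+ _ _ us)) ⟩
      suc k * (tupΣ us (suc k) below + lsum (λ x → tupΣ us k (prefix<≤ ℓ x)) us)
        ≡⟨ ℕₚ.*-distribˡ-+ (suc k) (tupΣ us (suc k) below) _ ⟩
      suc k * tupΣ us (suc k) below + suc k * lsum (λ x → tupΣ us k (prefix<≤ ℓ x)) us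
        ≤⟨ ℕₚ.+-monoʳ-≤ (suc k * tupΣ us (suc k) below) (crossing k ℓ 0<ℓ) ⟩
      suc k * tupΣ us (suc k) below + 2 * ℓ * N ^ suc k ∎

    -- Here the threshold is ℓ + 1: a sample with more than ℓ edges either had as many before its
    -- first entry was added or has just crossed ℓ + 1.
    above-step : ∀ k →
      suc k * tupΣ us (suc k) above ≤ suc k * (N * tupΣ us k above) + 2 * suc ℓ * N ^ suc k
    above-step k = begin
      suc k * tupΣ us (suc k) above
        ≤⟨ ℕₚ.*-monoʳ-≤ (suc k) (lsum-mono (λ x → tupΣ-mono us k (λ xs →
             ℕₚ.≤-trans (𝟙-split (ℓ <ᵇ edges (x ∷ xs)) (<ᵇ-dichotomy ℓ (edges xs)))
               (ℕₚ.≤-reflexive (cong (_+_ (above xs))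
                 (ℕₚ.*-comm (𝟙 (ℓ <ᵇ edges (x ∷ xs))) (𝟙 (edges xs <ᵇ suc ℓ))))))) us) ⟩
      suc k * lsum (λ x → tupΣ us k (λ xs → above xs + prefix<≤ (suc ℓ) x xs)) us
        ≡⟨ cong (suc k *_) (trans (lsum-cong (λ x → tupΣ-+ us k above (prefix<≤ (suc ℓ) x)) us)
             (trans (lsum-+ _ _ us) (cong (_+ S) (lsum-const (tupΣ us k above) us)))) ⟩
      suc k * (N * tupΣ us k above + S)
        ≡⟨ ℕₚ.*-distribˡ-+ (suc k) (N * tupΣ us k above) S ⟩
      suc k * (N * tupΣ us k above) + suc k * S
        ≤⟨ ℕₚ.+-monoʳ-≤ (suc k * (N * tupΣ us k above)) (crossing k (suc ℓ) z<s) ⟩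
      suc k * (N * tupΣ us k above) + 2 * suc ℓ * N ^ suc k ∎
      where
      S = lsum (λ x → tupΣ us k (prefix<≤ (suc ℓ) x)) us

    total : ∀ k → tupΣ us k below + tupΣ us k hit + tupΣ us k above ≡ N ^ k
    total k = begin-equality
      tupΣ us k below + tupΣ us k hit + tupΣ us k above
        ≡⟨ cong (_+ tupΣ us k above) (sym (tupΣ-+ us k below hit)) ⟩
      tupΣ us k (λ xs → below xs + hit xs) + tupΣ us k above
        ≡⟨ sym (tupΣ-+ us k _ above) ⟩
      tupΣ us k (λ xs → below xs + hit xs + above xs)
        ≡⟨ tupΣ-cong us k (λ xs → <ᵇ-trichotomy (edges xs) ℓ) ⟩
      tupΣ us k (λ _ → 1)
        ≡⟨ tupΣ-1 us k ⟩
      N ^ k ∎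

    -- The inequality of means turns p² ≤ 4qr into `k * P ≤ a + b`; adding `k * P` to both sides
    -- completes q + p + r to the whole space.
    hit-tuples≤ : 0 < ℓ → 0 < N → ∀ m → let k = suc m in
      2 * k * tupΣ us k hit ≤ (k + (4 * ℓ + 2)) * N ^ k
    hit-tuples≤ 0<ℓ 0<N m = begin
      2 * k * P                             ≡⟨ double k P ⟩
      k * P + k * P                         ≤⟨ ℕₚ.+-monoˡ-≤ (k * P) kP≤a+b ⟩
      a + b + k * P                         ≡⟨ collect k q r P ℓ W ⟩
      k * (q + P + r) + (4 * ℓ + 2) * W     ≡⟨ cong (λ z → k * z + (4 * ℓ + 2) * W) (total k) ⟩
      k * W + (4 * ℓ + 2) * W               ≡⟨ sym (ℕₚ.*-distribʳ-+ W k (4 * ℓ + 2)) ⟩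
      (k + (4 * ℓ + 2)) * W                 ∎
      where
      k = suc m
      W = N ^ k
      P = tupΣ us k hit
      q = tupΣ us k below
      r = tupΣ us k above
      Q = tupΣ us m below
      R = tupΣ us (suc k) above
      -- These bound kNQ and kR/N, where Q and R belong to sample sizes k - 1 and k + 1. The
      -- corrections add up to (4ℓ + 2)W.
      a = k * q + 2 * ℓ * W
      b = k * r + 2 * suc ℓ * W
      double : ∀ k p → 2 * k * p ≡ k * p + k * p
      double = solve-∀
      collect : ∀ k q r p l w → k * q + 2 * l * w + (k * r + 2 * suc l * w) + k * p
                              ≡ k * (q + p + r) + (4 * l + 2) * w
      collect = solve-∀
      kR≤Nb : k * R ≤ N * b
      kR≤Nb = ℕₚ.*-cancelˡ-≤ (suc k) (begin
        suc k * (k * R)                                   ≡⟨ exchange (suc k) k R ⟩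
        k * (suc k * R)                                   ≤⟨ ℕₚ.*-monoʳ-≤ k (above-step k) ⟩
        -- The crossing error 2(ℓ + 1)/(k + 1) is rounded up to 2(ℓ + 1)/k.
        k * (suc k * (N * r) + 2 * suc ℓ * (N * W))       ≤⟨ ℕₚ.m≤m+n _ (2 * suc ℓ * (N * W)) ⟩
        k * (suc k * (N * r) + 2 * suc ℓ * (N * W)) + 2 * suc ℓ * (N * W)
                                                          ≡⟨ regroup k N r ℓ W ⟩
        suc k * (N * b)                                   ∎)
        where
        exchange : ∀ x y z → x * (y * z) ≡ y * (x * z)
        exchange = solve-∀
        regroup : ∀ k n r l w → k * (suc k * (n * r) + 2 * suc l * (n * w)) + 2 * suc l * (n * w)
                              ≡ suc k * (n * (k * r + 2 * suc l * w))
        regroup = solve-∀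
      [kP]²≤ : (k * P) * (k * P) ≤ (2 * a) * (2 * b)
      [kP]²≤ = ℕₚ.*-cancelˡ-≤ N {{>-nonZero 0<N}} (begin
        N * ((k * P) * (k * P))       ≡⟨ regroup₁ N k P ⟩
        N * (k * k) * (P * P)         ≤⟨ ℕₚ.*-monoʳ-≤ (N * (k * k)) (hit²≤4*below*above 0<ℓ m) ⟩
        N * (k * k) * (4 * (Q * R))   ≡⟨ regroup₂ N k Q R ⟩
        4 * ((k * (N * Q)) * (k * R)) ≤⟨ ℕₚ.*-monoʳ-≤ 4 (ℕₚ.*-mono-≤ (below-step 0<ℓ m) kR≤Nb) ⟩
        4 * (a * (N * b))             ≡⟨ regroup₃ N a b ⟩
        N * ((2 * a) * (2 * b))       ∎)
        where
        regroup₁ : ∀ n k p → n * ((k * p) * (k * p)) ≡ n * (k * k) * (p * p)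
        regroup₁ = solve-∀
        regroup₂ : ∀ n k q r → n * (k * k) * (4 * (q * r)) ≡ 4 * ((k * (n * q)) * (k * r))
        regroup₂ = solve-∀
        regroup₃ : ∀ n a b → 4 * (a * (n * b)) ≡ n * ((2 * a) * (2 * b))
        regroup₃ = solve-∀
      kP≤a+b : k * P ≤ a + b
      kP≤a+b = ℕₚ.*-cancelˡ-≤ 2 (ℕₚ.≤-trans (x²≤uv⇒2x≤u+v (k * P) (2 * a) (2 * b) [kP]²≤)
        (ℕₚ.≤-reflexive (sym (ℕₚ.*-distribˡ-+ 2 a b))))

-- From tuples to subsets of size k.

-- Each k-subset has k! orderings among the tuples, and its edge count does not depend on the order.
hits≤tuples : ∀ {n} (G : Graph n) k ℓ →
              k ! * hits G k ℓ ≤ tupΣ (Vec.toList (Vec.allFin n)) k (spans G ℓ)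
hits≤tuples {n} G k ℓ = subst (λ h → k ! * h ≤ tupΣ us k (spans G ℓ)) (sym (hits-allFin G k ℓ))
  (subΣ≤tupΣ us k (spans G ℓ) (λ p → cong (λ z → 𝟙 (z ≡ᵇ ℓ)) (edgesL-↭ (adj G) (adj-sym G) p)))
  where
  us = Vec.toList (Vec.allFin n)

-- Two errors are absorbed in turn: c/k ≤ 1/s raises the numerator s to s + 1, and the loss k²/n ≤
-- 1/(s + 2) from tuples with repeated entries raises it to s + 2.
clear-denominators : ∀ k n f h b W c s → 0 < k → 0 < n → 0 < f →
  2 * k * (f * h) ≤ (k + c) * W → n * W ≤ n * (f * b) + k * k * W →
  c * s ≤ k → k * k * (s + 2) ≤ n → h * (2 * s) ≤ (s + 2) * b
clear-denominators k n f h b W c s 0<k 0<n 0<f hits≤ tuples≤ cs≤k k²[s+2]≤n =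
  ℕₚ.*-cancelˡ-≤ f {{>-nonZero 0<f}} (begin
    f * (h * (2 * s))     ≡⟨ regroup₁ f h s ⟩
    2 * s * (f * h)       ≤⟨ in-tuples ⟩
    (s + 1) * W           ≤⟨ in-subsets ⟩
    (s + 2) * (f * b)     ≡⟨ regroup₂ f b s ⟩
    f * ((s + 2) * b)     ∎)
  where
  regroup₁ : ∀ f h s → f * (h * (2 * s)) ≡ 2 * s * (f * h)
  regroup₁ = solve-∀
  regroup₂ : ∀ f b s → (s + 2) * (f * b) ≡ f * ((s + 2) * b)
  regroup₂ = solve-∀
  in-tuples : 2 * s * (f * h) ≤ (s + 1) * W
  in-tuples = ℕₚ.*-cancelˡ-≤ k {{>-nonZero 0<k}} (begin
    k * (2 * s * (f * h))      ≡⟨ regroup₃ k s (f * h) ⟩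
    s * (2 * k * (f * h))      ≤⟨ ℕₚ.*-monoʳ-≤ s hits≤ ⟩
    s * ((k + c) * W)          ≡⟨ regroup₄ k c s W ⟩
    (s * k + c * s) * W        ≤⟨ ℕₚ.*-monoˡ-≤ W (ℕₚ.+-monoʳ-≤ (s * k) cs≤k) ⟩
    (s * k + k) * W            ≡⟨ regroup₅ k s W ⟩
    k * ((s + 1) * W)          ∎)
    where
    regroup₃ : ∀ k s x → k * (2 * s * x) ≡ s * (2 * k * x)
    regroup₃ = solve-∀
    regroup₄ : ∀ k c s w → s * ((k + c) * w) ≡ (s * k + c * s) * w
    regroup₄ = solve-∀
    regroup₅ : ∀ k s w → (s * k + k) * w ≡ k * ((s + 1) * w)
    regroup₅ = solve-∀
  in-subsets : (s + 1) * W ≤ (s + 2) * (f * b)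
  -- The loss is added to both sides to avoid subtraction.
  in-subsets = ℕₚ.*-cancelˡ-≤ n {{>-nonZero 0<n}} (ℕₚ.+-cancelʳ-≤ (k * k * (s + 2) * W) _ _ (begin
    n * ((s + 1) * W) + k * k * (s + 2) * W   ≤⟨ ℕₚ.+-monoʳ-≤ (n * ((s + 1) * W)) (ℕₚ.*-monoˡ-≤ W k²[s+2]≤n) ⟩
    n * ((s + 1) * W) + n * W                 ≡⟨ regroup₆ n s W ⟩
    (s + 2) * (n * W)                         ≤⟨ ℕₚ.*-monoʳ-≤ (s + 2) tuples≤ ⟩
    (s + 2) * (n * (f * b) + k * k * W)       ≡⟨ regroup₇ n s (f * b) k W ⟩
    n * ((s + 2) * (f * b)) + k * k * (s + 2) * W ∎))
    where
    regroup₆ : ∀ n s w → n * ((s + 1) * w) + n * w ≡ (s + 2) * (n * w)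
    regroup₆ = solve-∀
    regroup₇ : ∀ n s x k w → (s + 2) * (n * x + k * k * w) ≡ n * ((s + 2) * x) + k * k * (s + 2) * w
    regroup₇ = solve-∀

hits≤half : ∀ {n} (G : Graph n) k ℓ s → 0 < ℓ → 0 < k → 0 < n →
  (4 * ℓ + 2) * s ≤ k → k * k * (s + 2) ≤ n → hits G k ℓ * (2 * s) ≤ (s + 2) * binom n k
hits≤half {n} G k@(suc m) ℓ s 0<ℓ 0<k 0<n =
  clear-denominators k n (k !) (hits G k ℓ) (binom n k) (n ^ k) (4 * ℓ + 2) s 0<k 0<n (ℕₚ.1≤n! k)
    (ℕₚ.≤-trans (ℕₚ.*-monoʳ-≤ (2 * k) (hits≤tuples G k ℓ)) tuples≤) (^≤falling n k)
  where
  us = Vec.toList (Vec.allFin n)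
  length-us : length us ≡ n
  length-us = Vecₚ.length-toList (Vec.allFin n)
  open Sampling us (adj G) (adj-sym G) using (hit-tuples≤)
  tuples≤ : 2 * k * tupΣ us k (spans G ℓ) ≤ (k + (4 * ℓ + 2)) * n ^ k
  -- For the adjacency of G, `hit` unfolds to `spans G ℓ`; only the number of vertices is rewritten.
  tuples≤ = subst (λ N → 2 * k * tupΣ us k (spans G ℓ) ≤ (k + (4 * ℓ + 2)) * N ^ k) length-us
    (hit-tuples≤ ℓ 0<ℓ (subst (0 <_) (sym length-us) 0<n) m)

-- Passage to the limit.

I≤half : ∀ ℓ → 0 < ℓ → ∀ ε → 0ℚ <ℚ ε → ∃[ k₀ ] ∀ k → k₀ ≤ k →
         ∃[ M ] ∀ m → M ≤ m → I-seq k ℓ m ℚ.≤ (+ 1 / 2) +ℚ ε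
I≤half ℓ 0<ℓ (ℚ.mkℚ (+ zero) q _) (ℚ.*<* (+<+ ()))
I≤half ℓ 0<ℓ (ℚ.mkℚ -[1+ p ] q _) (ℚ.*<* ())
I≤half ℓ 0<ℓ (ℚ.mkℚ +[1+ p ] q cop) _ =
  -- With s = q + 1 the bound (s + 2)/(2s) equals 1/2 + 1/s, and ε ≥ 1/s. The first threshold makes
  -- k large against (4ℓ + 2)s, its outer `suc` giving k > 0; the second makes n large against k².
  suc ((4 * ℓ + 2) * suc q) , λ k k₀≤k → k * k * (suc q + 2) , λ m M≤m →
    bound k m (ℕₚ.<-≤-trans z<s k₀≤k) (ℕₚ.<⇒≤ k₀≤k) (ℕₚ.≤-trans M≤m (ℕₚ.m≤n+m m k))
  where
  bound : ∀ k m → 0 < k → (4 * ℓ + 2) * suc q ≤ k → k * k * (suc q + 2) ≤ k + m →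
          I-seq k ℓ m ℚ.≤ (+ 1 / 2) +ℚ ℚ.mkℚ +[1+ p ] q cop
  bound k m 0<k k-large n-large = compare (I-attained n k ℓ k≤n)
    where
    n = k + m
    k≤n = ℕₚ.m≤m+n k m
    C = length (kSubsets n k)
    compare : (∃[ G ] I n k ℓ k≤n ≡ prob G k ℓ k≤n) →
              I n k ℓ k≤n ℚ.≤ (+ 1 / 2) +ℚ ℚ.mkℚ +[1+ p ] q cop
    compare (G , I≡G) = subst (ℚ._≤ (+ 1 / 2) +ℚ ℚ.mkℚ +[1+ p ] q cop) (sym I≡G)
      (/-≤-+ (hits G k ℓ) C 1 2 p q {{kSubsets-nonZero k≤n}} {cop = cop} (begin
        hits G k ℓ * (2 * suc q)
          ≤⟨ hits≤half G k ℓ (suc q) 0<ℓ 0<k (ℕₚ.<-≤-trans 0<k k≤n) k-large n-large ⟩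
        (suc q + 2) * binom n k
          ≤⟨ ℕₚ.*-monoˡ-≤ (binom n k) (ℕₚ.+-mono-≤ (ℕₚ.m≤m+n (suc q) 0) (ℕₚ.m≤m+n 2 (p * 2))) ⟩
        (1 * suc q + suc p * 2) * binom n k
          ≡⟨ cong ((1 * suc q + suc p * 2) *_) (sym (length-kSubsets n k)) ⟩
        (1 * suc q + suc p * 2) * C ∎))

-- Both parts of the theorem are instances, with c = 3/4 and c = 1/2. The bound holds on a tail of
-- the sequence defining `ind`, hence with any slack δ.
ind≤ : ∀ c → (+ 1 / 2) ℚ.≤ c → ∀ ℓ → 0 < ℓ → ∀ ε → 0ℚ <ℚ ε →
       ∃[ k₀ ] ∀ k → k₀ ≤ k → ind k ℓ ≤ᵣ fromℚ (c +ℚ ε)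
ind≤ c ½≤c ℓ 0<ℓ ε 0<ε = proj₁ half , λ k k₀≤k δ 0<δ →
  proj₁ (proj₂ half k k₀≤k) , λ m M≤m →
    ℚₚ.≤-trans (proj₂ (proj₂ half k k₀≤k) m M≤m) (½+ε≤ δ 0<δ)
  where
  half : ∃[ k₀ ] ∀ k → k₀ ≤ k → ∃[ M ] ∀ m → M ≤ m → I-seq k ℓ m ℚ.≤ (+ 1 / 2) +ℚ ε
  half = I≤half ℓ 0<ℓ ε 0<ε
  ½+ε≤ : ∀ δ → 0ℚ <ℚ δ → (+ 1 / 2) +ℚ ε ℚ.≤ c +ℚ ε +ℚ δ
  ½+ε≤ δ 0<δ = ℚₚ.≤-trans (ℚₚ.+-monoˡ-≤ ε ½≤c)
    (ℚₚ.≤-trans (ℚₚ.≤-reflexive (sym (ℚₚ.+-identityʳ (c +ℚ ε))))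
                (ℚₚ.+-monoʳ-≤ (c +ℚ ε) (ℚₚ.<⇒≤ 0<δ)))

theorem1p6 : (∀ (ℓ : ℕ) → 0 < ℓ → ∀ (ε : ℚ) → 0ℚ <ℚ ε →
    ∃[ k₀ ] ∀ (k : ℕ) → k₀ ≤ k → ind k ℓ ≤ᵣ fromℚ ((+ 3 / 4) +ℚ ε))
    × (∀ (ε : ℚ) → 0ℚ <ℚ ε →
    ∃[ k₀ ] ∀ (k : ℕ) → k₀ ≤ k → ind k 1 ≤ᵣ fromℚ ((+ 1 / 2) +ℚ ε))
theorem1p6 =
    ind≤ (+ 3 / 4) (from-yes ((+ 1 / 2) ℚₚ.≤? (+ 3 / 4)))
  , ind≤ (+ 1 / 2) ℚₚ.≤-refl 1 z<s
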